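{- Let $L$ be a finite congruence uniform lattice. The following are equivalent: (i) $L$ is extremal; (ii) $L$ is left modular; (iii) $L$ is $EL$-shellable; (iv) $L$ is shellable.
   Context: For a convex subset $C$ of $L$, $I_L(C)=\{y\mid\exists x\in C,y\le x\}$ and the doubling $L[C]$ is the subposet of $L\times\{0<1\}$ on $(I_L(C)\times\{0\})\sqcup\big(((L\setminus I_L(C))\cup C)\times\{1\}\big)$. $L$ is congruence uniform if obtained from the one-element lattice by finitely many doublings of nonempty intervals. $L$ is extremal if its maximum chain length $\ell(L)$ (max of $|F|-1$ over chains) equals both the number of join-irreducibles (elements covering exactly one element) and of meet-irreducibles (elements covered by exactly one element). An element $a$ is left modular if for all $b<c$, $(b\vee a)\wedge c=b\vee(a\wedge c)$; $L$ is left modular if it has a maximal chain of left modular elements. An $EL$-labelling is a map from the cover relations of $L$ to a poset such that in every interval $[x,y]$ there is a unique maximal chain whose sequence of labels read bottom to top is increasing, and its label word lexicographically precedes the label word of every other maximal chain of $[x,y]$; $L$ is $EL$-shellable if it admits an $EL$-labelling. $L$ is shellable if its order complex (vertex set $L$, faces the chains) admits a shelling: a linear order $F_1,\dots,F_k$ of the maximal chains such that for each $j<k$, $\big(\bigcup_{i\le j}\langle F_i\rangle\big)\cap\langle F_{j+1}\rangle$ is pure of dimension $|F_{j+1}|-2$, with $\langle F\rangle$ the set of subsets of $F$. -}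

module Defs where

open import Level using (0ℓ; Level) renaming (suc to lsuc)
open import Data.Nat using (ℕ; suc; _∸_) renaming (_≤_ to _≤ℕ_)
open import Data.Fin using (Fin)
open import Data.Bool using (Bool; true; false) renaming (_≤_ to _≤ᵇ_)
open import Data.Bool.Properties using () renaming (≤-isPartialOrder to ≤ᵇ-isPartialOrder)
open import Data.Unit using (⊤; tt)
open import Data.Empty using (⊥)
open import Data.Product using (Σ; ∃; ∃-syntax; _×_; _,_; proj₁; proj₂)
open import Data.Sum using (_⊎_)
open import Data.List using (List; []; _∷_; _++_; length)
open import Data.List.Relation.Unary.All using (All)
open import Data.List.Relation.Unary.Any using (Any)
open import Data.List.Relation.Unary.Linked using (Linked)
open import Data.List.Relation.Unary.Unique.Propositional using (Unique)
open import Data.List.Membership.Propositional using (_∈_)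
open import Data.List.Relation.Binary.Subset.Propositional using (_⊆_)
open import Data.List.Relation.Binary.Lex.Core using (Lex-<)
open import Relation.Nullary using (¬_)
open import Relation.Binary using (Rel; Poset; IsPartialOrder; IsPreorder; IsEquivalence)
open import Relation.Binary.Lattice using (IsLattice)
open import Relation.Binary.PropositionalEquality using (_≡_; _≢_; refl)
import Relation.Binary.PropositionalEquality as Eq

record FinLattice : Set₁ where
  field
    n        : ℕ
    _≤_      : Rel (Fin n) 0ℓ
    _∨_      : Fin n → Fin n → Fin n
    _∧_      : Fin n → Fin n → Fin n
    isLattice : IsLattice _≡_ _≤_ _∨_ _∧_

  Elt : Set
  Elt = Fin n

  _<_ : Rel Elt 0ℓ
  x < y = x ≤ y × x ≢ y

  _⋖_ : Rel Elt 0ℓ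
  x ⋖ y = x < y × (∀ z → x < z → z < y → ⊥)

  JoinIrreducible : Elt → Set
  JoinIrreducible x = ∃[ y ] (y ⋖ x × (∀ z → z ⋖ x → z ≡ y))

  MeetIrreducible : Elt → Set
  MeetIrreducible x = ∃[ y ] (x ⋖ y × (∀ z → x ⋖ z → z ≡ y))

  HasCount : (Elt → Set) → ℕ → Set
  HasCount P k = Σ (List Elt) λ xs →
    Unique xs × (∀ x → (P x → x ∈ xs) × (x ∈ xs → P x)) × length xs ≡ k

  IsChain : List Elt → Set
  IsChain = Linked _<_

  IsMaximalChainIn : (Elt → Set) → List Elt → Set
  IsMaximalChainIn S xs =
    IsChain xs × All S xs ×
    (∀ ys → IsChain ys → All S ys → xs ⊆ ys → ys ⊆ xs)

  IsMaximalChain : List Elt → Set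
  IsMaximalChain = IsMaximalChainIn (λ _ → ⊤)

  Interval : Elt → Elt → Elt → Set
  Interval x y z = x ≤ z × z ≤ y

  IsMaxChainLength : ℕ → Set
  IsMaxChainLength ℓ =
    (∃[ xs ] (IsChain xs × length xs ≡ suc ℓ)) ×
    (∀ xs → IsChain xs → length xs ≤ℕ suc ℓ)

  Extremal : Set
  Extremal = ∃[ ℓ ] (IsMaxChainLength ℓ × HasCount JoinIrreducible ℓ
                                        × HasCount MeetIrreducible ℓ)

  LeftModularElement : Elt → Set
  LeftModularElement a = ∀ b c → b < c → ((b ∨ a) ∧ c) ≡ (b ∨ (a ∧ c))

  LeftModular : Set
  LeftModular = ∃[ xs ] (IsMaximalChain xs × All LeftModularElement xs)

  -- Edge labellings into a poset P (the label is a function of the pair;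
  -- only its values on cover relations are ever used).
  module _ (P : Poset 0ℓ 0ℓ 0ℓ) where
    private module P = Poset P

    _<ₚ_ : Rel P.Carrier 0ℓ
    a <ₚ b = a P.≤ b × ¬ (a P.≈ b)

    labelWord : (Elt → Elt → P.Carrier) → List Elt → List P.Carrier
    labelWord λ' (a ∷ b ∷ r) = λ' a b ∷ labelWord λ' (b ∷ r)
    labelWord λ' _           = []

    IsELLabelling : (Elt → Elt → P.Carrier) → Set
    IsELLabelling λ' = ∀ x y → x ≤ y → Σ (List Elt) λ c →
      IsMaximalChainIn (Interval x y) c ×
      Linked _<ₚ_ (labelWord λ' c) ×
      (∀ c' → IsMaximalChainIn (Interval x y) c' →
         Linked _<ₚ_ (labelWord λ' c') → c' ≡ c) ×
      (∀ c' → IsMaximalChainIn (Interval x y) c' → c' ≢ c →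
         Lex-< P._≈_ _<ₚ_ (labelWord λ' c) (labelWord λ' c'))

  ELShellable : Set₁
  ELShellable = Σ (Poset 0ℓ 0ℓ 0ℓ) λ P →
                Σ (Elt → Elt → Poset.Carrier P) λ λ' → IsELLabelling P λ'

  -- Order complex: faces are chains, represented as duplicate-free lists
  -- of vertices.  For facets F₁ … F_j and F = F_{j+1}, the complex
  -- (⋃_{i ≤ j} ⟨F_i⟩) ∩ ⟨F⟩ :
  ShellFace : List (List Elt) → List Elt → List Elt → Set
  ShellFace pre F G = Unique G × G ⊆ F × Any (λ Fi → G ⊆ Fi) pre

  -- pure of dimension |F| - 2 : every facet (maximal face) has |F| - 1 vertices
  PureOfDim : (List Elt → Set) → ℕ → Set
  PureOfDim K size = ∀ G → K G → (∀ H → K H → G ⊆ H → H ⊆ G) → length G ≡ size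

  IsShelling : List (List Elt) → Set
  IsShelling Fs =
    All IsMaximalChain Fs × Unique Fs × (∀ F → IsMaximalChain F → F ∈ Fs) ×
    (∀ pre F post → Fs ≡ pre ++ (F ∷ post) → pre ≢ [] →
       PureOfDim (ShellFace pre F) (length F ∸ 1))

  Shellable : Set
  Shellable = ∃[ Fs ] IsShelling Fs

  poset : Poset 0ℓ 0ℓ 0ℓ
  poset = record { Carrier = Elt ; _≈_ = _≡_ ; _≤_ = _≤_
                 ; isPartialOrder = IsLattice.isPartialOrder isLattice }

-- Doubling of a convex set, specialised to intervals [a , b].

module Doubling (L : Poset 0ℓ 0ℓ 0ℓ) (a b : Poset.Carrier L) where
  open Poset L using (Carrier; _≈_; _≤_; reflexive; trans; antisym)

  C : Carrier → Set
  C x = a ≤ x × x ≤ b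

  I : Carrier → Set
  I y = ∃[ x ] (C x × y ≤ x)

  Mem : Carrier × Bool → Set
  Mem (y , false) = I y
  Mem (y , true)  = ¬ I y ⊎ C y

  DCarrier : Set
  DCarrier = Σ (Carrier × Bool) Mem

  _≈D_ : Rel DCarrier 0ℓ
  ((x , s) , _) ≈D ((y , t) , _) = x ≈ y × s ≡ t

  _≤D_ : Rel DCarrier 0ℓ
  ((x , s) , _) ≤D ((y , t) , _) = x ≤ y × s ≤ᵇ t

  private
    module B = IsPartialOrder ≤ᵇ-isPartialOrder

  isPO : IsPartialOrder _≈D_ _≤D_
  isPO = record
    { isPreorder = record
      { isEquivalence = record
        { refl  = Eq′ (Poset.Eq.refl L) Eq.refl
        ; sym   = λ { (p , q) → Poset.Eq.sym L p , Eq.sym q }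
        ; trans = λ { (p , q) (p' , q') → Poset.Eq.trans L p p' , Eq.trans q q' } }
      ; reflexive = λ { (p , q) → reflexive p , B.reflexive q }
      ; trans = λ { (p , q) (p' , q') → trans p p' , B.trans q q' } }
    ; antisym = λ { (p , q) (p' , q') → antisym p p' , B.antisym q q' } }
    where Eq′ : ∀ {x y : Carrier} {s t : Bool} → x ≈ y → s ≡ t → x ≈ y × s ≡ t
          Eq′ p q = p , q

  doubled : Poset 0ℓ 0ℓ 0ℓ
  doubled = record { Carrier = DCarrier ; _≈_ = _≈D_ ; _≤_ = _≤D_
                   ; isPartialOrder = isPO }

onePoset : Poset 0ℓ 0ℓ 0ℓ
onePoset = record { Carrier = ⊤ ; _≈_ = _≡_ ; _≤_ = λ _ _ → ⊤
                  ; isPartialOrder = record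
                    { isPreorder = record { isEquivalence = Eq.isEquivalence
                                          ; reflexive = λ _ → tt ; trans = λ _ _ → tt }
                    ; antisym = λ { {tt} {tt} _ _ → refl } } }

data ObtainedByDoublings : Poset 0ℓ 0ℓ 0ℓ → Set₁ where
  one    : ObtainedByDoublings onePoset
  double : ∀ {P} → ObtainedByDoublings P → (a b : Poset.Carrier P) →
           Poset._≤_ P a b → ObtainedByDoublings (Doubling.doubled P a b)

record OrderIso (P Q : Poset 0ℓ 0ℓ 0ℓ) : Set where
  private
    module P = Poset P
    module Q = Poset Q
  field
    to      : P.Carrier → Q.Carrier
    from    : Q.Carrier → P.Carrier
    from-to : ∀ x → from (to x) P.≈ x
    to-from : ∀ y → to (from y) Q.≈ y
    to-mono : ∀ x y → x P.≤ y → to x Q.≤ to y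
    to-refl : ∀ x y → to x Q.≤ to y → x P.≤ y

CongruenceUniform : FinLattice → Set₁
CongruenceUniform L = Σ (Poset 0ℓ 0ℓ 0ℓ) λ Q →
  ObtainedByDoublings Q × OrderIso (FinLattice.poset L) Q

-- A congruence uniform lattice is semidistributive.  Say that a maximal chain F
-- sees a join-irreducible j, with lower cover j*, if j* ≤ x and j ≰ x for some
-- x ∈ F; each of the four properties is equivalent to the existence of a maximal
-- chain that sees every join-irreducible.  Meet semidistributivity makes the
-- elements of such a chain left modular, and conversely a left modular chain sees
-- everything.  By join semidistributivity each step of a chain sees at most one
-- join-irreducible, so seeing all of them means having as many steps as there are
-- join-irreducibles, which is extremality once the dual is counted too.  Replacing
-- one vertex of a maximal chain does not lose any join-irreducible it sees; hence
-- in a shelling the first facet sees everything, and in an EL-labelling so does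
-- the increasing maximal chain.  Finally a left modular chain gives an
-- EL-labelling by natural numbers, and ordering the maximal chains
-- lexicographically by their label words gives a shelling.
module Submission where

open import Defs
open import Level using (0ℓ)
open import Data.Nat using (ℕ; zero; suc; _∸_; z≤n; s≤s) renaming (_≤_ to _≤ℕ_; _<_ to _<ℕ_)
import Data.Nat.Properties as ℕ
open import Data.Fin using (Fin)
import Data.Fin.Properties as Fin
open import Data.Fin.Induction using (spo-wellFounded; spo-noetherian)
open import Data.Bool using (true; false; b≤b) renaming (_≤_ to _≤ᵇ_)
import Data.Bool.Properties as Bool
open import Data.Unit using (tt)
open import Data.Empty using (⊥; ⊥-elim)
open import Data.Product using (Σ; ∃-syntax; ∃₂; _×_; _,_; proj₁; proj₂)
open import Data.Sum using (_⊎_; inj₁; inj₂; map₂; [_,_])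
open import Data.List using (List; []; _∷_; _++_; length; filter; foldr; allFin; lookup; concatMap; map; deduplicate)
import Data.List.Properties as List
open import Data.List.Relation.Unary.All as All using (All; []; _∷_)
open import Data.List.Relation.Unary.Any as Any using (Any; here; there)
import Data.List.Relation.Unary.Any.Properties as Any
open import Data.List.Relation.Unary.AllPairs as AllPairs using (AllPairs; []; _∷_)
open import Data.List.Relation.Unary.Linked as Linked using (Linked; []; [-]; _∷_)
import Data.List.Relation.Unary.Linked.Properties as Linked
open import Data.List.Relation.Unary.Unique.Propositional using (Unique)
import Data.List.Relation.Unary.Unique.Propositional.Properties as Unique
open import Data.List.Membership.Propositional using (_∈_; _∉_; find; lose)
import Data.List.Membership.Propositional.Properties as ∈
open import Data.List.Relation.Binary.Subset.Propositional using (_⊆_)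
open import Data.List.Relation.Binary.Lex.Core using (Lex-<; halt; this; next)
import Data.List.Relation.Binary.Lex.NonStrict as Lex
open import Data.List.Relation.Binary.Lex.Strict using (xs≮[])
open import Data.List.Relation.Binary.Permutation.Propositional using (↭-sym; ↭⇒↭ₛ)
open import Data.List.Relation.Binary.Permutation.Propositional.Properties using (∈-resp-↭)
open import Data.List.Relation.Binary.Permutation.Setoid.Properties using (Unique-resp-↭)
import Relation.Binary.Construct.On as On
import Relation.Binary.Construct.Flip.EqAndOrd as Flip
open import Function using (flip; _∘_; id)
open import Function.Bundles using (_⇔_; mk⇔)
open import Induction.WellFounded using (Acc; acc; WellFounded)
open import Relation.Nullary using (¬_; Dec; yes; no)
open import Relation.Nullary.Decidable using (map′; _×-dec_; ¬?; decidable-stable)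
open import Relation.Binary using (Rel; Poset; IsStrictPartialOrder; DecTotalOrder)
open import Relation.Binary.Lattice using (IsLattice)
open import Relation.Binary.PropositionalEquality
  using (_≡_; _≢_; refl; sym; trans; cong; subst; isEquivalence; resp₂; setoid)

-- Semidistributivity and its preservation under doubling

-- Join semidistributivity x ∨ y = x ∨ z ⇒ x ∨ y = x ∨ (y ∧ z), phrased with
-- upper and lower bounds so that it makes sense in a bare poset.
JoinSD : {A : Set} → Rel A 0ℓ → Set
JoinSD {A} _≤_ = ∀ (x y z m u : A) → x ≤ m → y ≤ m → z ≤ m →
  (∀ t → x ≤ t → y ≤ t → m ≤ t) → (∀ t → x ≤ t → z ≤ t → m ≤ t) →
  x ≤ u → (∀ t → t ≤ y → t ≤ z → t ≤ u) → m ≤ u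

MeetSD : {A : Set} → Rel A 0ℓ → Set
MeetSD _≤_ = JoinSD (flip _≤_)

module DoublingSD (P : Poset 0ℓ 0ℓ 0ℓ) (a b : Poset.Carrier P) (a≤b : Poset._≤_ P a b)
                  (_≤?_ : ∀ x y → Dec (Poset._≤_ P x y)) where
  private
    module P = Poset P
  open P using (Carrier; _≤_)
  open Doubling P a b

  private
    inI : ∀ {y} → y ≤ b → I y
    inI y≤b = b , (a≤b , P.refl) , y≤b

    I⇒≤b : ∀ {y} → I y → y ≤ b
    I⇒≤b (x , (_ , x≤b) , y≤x) = P.trans y≤x x≤b

  π : DCarrier → Carrier
  π ((x , _) , _) = x

  _≤D?_ : ∀ p q → Dec (p ≤D q)
  ((x , s) , _) ≤D? ((y , t) , _) = (x ≤? y) ×-dec (s Bool.≤? t)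

  -- The upper copy of `t` serves when there is one. It is missing only if `t ≤ b` and `a ≰ t`, and
  -- then everything over an element below `t` is on the lower level, so the lower copy serves.
  lift-upper : ∀ t p q → π p ≤ t → π q ≤ t → ∃[ r ] (π r ≡ t × p ≤D r × q ≤D r)
  lift-upper t p q p≤t q≤t with t ≤? b | a ≤? t
  ... | no t≰b  | _ =
    ((t , true) , inj₁ (t≰b ∘ I⇒≤b)) , refl , (p≤t , Bool.≤-maximum _) , (q≤t , Bool.≤-maximum _)
  ... | yes t≤b | yes a≤t =
    ((t , true) , inj₂ (a≤t , t≤b)) , refl , (p≤t , Bool.≤-maximum _) , (q≤t , Bool.≤-maximum _)
  ... | yes t≤b | no a≰t =
    ((t , false) , inI t≤b) , refl , (p≤t , lower p p≤t) , (q≤t , lower q q≤t)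
    where
    lower : ∀ r → π r ≤ t → proj₂ (proj₁ r) ≤ᵇ false
    lower ((_ , false) , _) _ = b≤b
    lower ((x , true) , inj₁ ¬Ix) x≤t = ⊥-elim (¬Ix (inI (P.trans x≤t t≤b)))
    lower ((x , true) , inj₂ (a≤x , _)) x≤t = ⊥-elim (a≰t (P.trans a≤x x≤t))

  lift-lower : ∀ t p q → t ≤ π p → t ≤ π q → ∃[ r ] (π r ≡ t × r ≤D p × r ≤D q)
  lift-lower t p q t≤p t≤q with t ≤? b
  ... | yes t≤b =
    ((t , false) , inI t≤b) , refl , (t≤p , Bool.≤-minimum _) , (t≤q , Bool.≤-minimum _)
  ... | no t≰b =
    ((t , true) , inj₁ (t≰b ∘ I⇒≤b)) , refl , (t≤p , upper p t≤p) , (t≤q , upper q t≤q)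
    where
    upper : ∀ r → t ≤ π r → true ≤ᵇ proj₂ (proj₁ r)
    upper ((_ , true) , _) _ = b≤b
    upper ((x , false) , Ix) t≤x = ⊥-elim (t≰b (P.trans t≤x (I⇒≤b Ix)))

  private
    -- The bottom of the upper copy of the interval and the top of its lower copy; comparison with
    -- them settles the levels below.
    bottomC topC : DCarrier
    bottomC = (a , true) , inj₂ (P.refl , a≤b)
    topC    = (b , false) , inI P.refl

  -- The first coordinate follows from the hypothesis on `P`, since bounds lift along `π`. For the
  -- levels only `m` upper and `u` lower is critical. Then `x ≤ topC`, so `y ≤ topC` would force
  -- `m ≤ topC`; hence `y`, and likewise `z`, is above `bottomC`, which gives `bottomC ≤ u` and with
  -- it the comparison of levels.
  joinSD : JoinSD _≤_ → JoinSD _≤D_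
  joinSD sd x y z m u x≤m y≤m z≤m lub₁ lub₂ x≤u glb = πm≤πu , level m u πm≤πu lub₁ lub₂ y≤m z≤m x≤u glb
    where
    πm≤πu : π m ≤ π u
    πm≤πu = sd (π x) (π y) (π z) (π m) (π u) (proj₁ x≤m) (proj₁ y≤m) (proj₁ z≤m)
      (λ t p q → let r , e , x≤r , y≤r = lift-upper t x y p q in subst (π m ≤_) e (proj₁ (lub₁ r x≤r y≤r)))
      (λ t p q → let r , e , x≤r , y≤r = lift-upper t x z p q in subst (π m ≤_) e (proj₁ (lub₂ r x≤r y≤r)))
      (proj₁ x≤u)
      (λ t p q → let r , e , r≤y , r≤z = lift-lower t y z p q in subst (_≤ π u) e (proj₁ (glb r r≤y r≤z)))

    a≤y : ∀ m y → π m ≤ b → proj₂ (proj₁ m) ≡ true → y ≤D m → x ≤D topC →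
          (∀ t → x ≤D t → y ≤D t → m ≤D t) → bottomC ≤D y
    a≤y m ((y , true) , inj₁ ¬Iy) m≤b _ y≤m _ _ = ⊥-elim (¬Iy (inI (P.trans (proj₁ y≤m) m≤b)))
    a≤y m ((y , true) , inj₂ (a≤y , _)) m≤b _ y≤m _ _ = a≤y , b≤b
    a≤y m@((_ , true) , _) ((y , false) , Iy) m≤b refl y≤m x≤top lub
      with () ← proj₂ (lub topC x≤top (I⇒≤b Iy , b≤b))

    level : ∀ m u → π m ≤ π u →
      (∀ t → x ≤D t → y ≤D t → m ≤D t) → (∀ t → x ≤D t → z ≤D t → m ≤D t) → y ≤D m → z ≤D m →
      x ≤D u → (∀ t → t ≤D y → t ≤D z → t ≤D u) → proj₂ (proj₁ m) ≤ᵇ proj₂ (proj₁ u)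
    level ((_ , false) , _) _ _ _ _ _ _ _ _ = Bool.≤-minimum _
    level ((_ , true) , _) ((_ , true) , _) _ _ _ _ _ _ _ = b≤b
    level m@((_ , true) , _) u@((_ , false) , Iu) m≤u lub₁ lub₂ y≤m z≤m x≤u glb =
      proj₂ (glb bottomC (a≤y m y m≤b refl y≤m x≤top lub₁) (a≤y m z m≤b refl z≤m x≤top lub₂))
      where
      m≤b : π m ≤ b
      m≤b = P.trans m≤u (I⇒≤b Iu)
      x≤top : x ≤D topC
      x≤top = P.trans (proj₁ x≤u) (I⇒≤b Iu) , proj₂ x≤u

  -- When `u` is upper and `m` lower, `m` lies over the interval and has an upper copy. If `y` were
  -- upper, that copy would be a lower bound of `x` and `y` not below `m`; so `y`, and likewise `z`,
  -- is below `topC`, and therefore so is `u`.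
  meetSD : MeetSD _≤_ → MeetSD _≤D_
  meetSD sd x y z m u m≤x m≤y m≤z glb₁ glb₂ u≤x lub = πu≤πm , level m u πu≤πm glb₁ glb₂ u≤x lub m≤x m≤y m≤z
    where
    πu≤πm : π u ≤ π m
    πu≤πm = sd (π x) (π y) (π z) (π m) (π u) (proj₁ m≤x) (proj₁ m≤y) (proj₁ m≤z)
      (λ t p q → let r , e , r≤x , r≤y = lift-lower t x y p q in subst (_≤ π m) e (proj₁ (glb₁ r r≤x r≤y)))
      (λ t p q → let r , e , r≤x , r≤y = lift-lower t x z p q in subst (_≤ π m) e (proj₁ (glb₂ r r≤x r≤y)))
      (proj₁ u≤x)
      (λ t p q → let r , e , y≤r , z≤r = lift-upper t y z p q in subst (π u ≤_) e (proj₁ (lub r y≤r z≤r)))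

    y≤b : ∀ m y → C (π m) → proj₂ (proj₁ m) ≡ false → m ≤D x → m ≤D y → bottomC ≤D x →
          (∀ t → t ≤D x → t ≤D y → t ≤D m) → y ≤D topC
    y≤b m ((y , false) , Iy) _ _ _ _ _ _ = I⇒≤b Iy , b≤b
    y≤b m@((m′ , false) , _) ((y , true) , _) Cm refl m≤x m≤y bot≤x glb
      with () ← proj₂ (glb ((m′ , true) , inj₂ Cm) (proj₁ m≤x , proj₂ bot≤x) (proj₁ m≤y , b≤b))

    level : ∀ m u → π u ≤ π m →
      (∀ t → t ≤D x → t ≤D y → t ≤D m) → (∀ t → t ≤D x → t ≤D z → t ≤D m) →
      u ≤D x → (∀ t → y ≤D t → z ≤D t → u ≤D t) → m ≤D x → m ≤D y → m ≤D z →
      proj₂ (proj₁ u) ≤ᵇ proj₂ (proj₁ m)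
    level _ ((_ , false) , _) _ _ _ _ _ _ _ _ = Bool.≤-minimum _
    level ((_ , true) , _) ((_ , true) , _) _ _ _ _ _ _ _ _ = b≤b
    level m@((_ , false) , Im) ((u , true) , inj₁ ¬Iu) u≤m _ _ _ _ _ _ _ =
      ⊥-elim (¬Iu (inI (P.trans u≤m (I⇒≤b Im))))
    level m@((_ , false) , Im) u@((_ , true) , inj₂ (a≤u , _)) u≤m glb₁ glb₂ u≤x lub m≤x m≤y m≤z =
      proj₂ (lub topC (y≤b m y Cm refl m≤x m≤y bot≤x glb₁) (y≤b m z Cm refl m≤x m≤z bot≤x glb₂))
      where
      Cm : C (π m)
      Cm = P.trans a≤u u≤m , I⇒≤b Im
      bot≤x : bottomC ≤D x
      bot≤x = P.trans a≤u (proj₁ u≤x) , proj₂ u≤x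

-- `element` is carried along because a `FinLattice` may be empty, and `dec` because the doubling
-- step splits on comparisons with `a` and `b`.
record SemidistributivePoset (P : Poset 0ℓ 0ℓ 0ℓ) : Set where
  open Poset P using (Carrier; _≤_)
  field
    element : Carrier
    dec     : ∀ x y → Dec (x ≤ y)
    joinSD  : JoinSD _≤_
    meetSD  : MeetSD _≤_

doublings⇒semidistributive : ∀ {P} → ObtainedByDoublings P → SemidistributivePoset P
doublings⇒semidistributive one = record
  { element = tt
  ; dec     = λ _ _ → yes tt
  ; joinSD  = λ _ _ _ _ _ _ _ _ _ _ _ _ → tt
  ; meetSD  = λ _ _ _ _ _ _ _ _ _ _ _ _ → tt }
doublings⇒semidistributive (double {P} d a b a≤b) = record
  { element = (b , false) , (b , (a≤b , Poset.refl P) , Poset.refl P)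
  ; dec     = D._≤D?_
  ; joinSD  = D.joinSD joinSD
  ; meetSD  = D.meetSD meetSD }
  where
  open SemidistributivePoset (doublings⇒semidistributive d)
  module D = DoublingSD P a b a≤b dec

-- Only inequalities relate `f` and `g`, so the same lemma applied to the reversed orders transfers
-- meet semidistributivity.
joinSD-surj : {A B : Set} {_≤_ : Rel A 0ℓ} {_⊑_ : Rel B 0ℓ} (f : A → B) (g : B → A) →
  (∀ y → f (g y) ⊑ y) → (∀ y → y ⊑ f (g y)) → (∀ {x y z} → x ⊑ y → y ⊑ z → x ⊑ z) →
  (∀ x y → x ≤ y → f x ⊑ f y) → (∀ x y → f x ⊑ f y → x ≤ y) →
  JoinSD _⊑_ → JoinSD _≤_
joinSD-surj {_≤_ = _≤_} {_⊑_} f g fg⊑ ⊑fg tr mono refl′ sd x y z m u x≤m y≤m z≤m l₁ l₂ x≤u glb =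
  refl′ m u (sd (f x) (f y) (f z) (f m) (f u) (mono x m x≤m) (mono y m y≤m) (mono z m z≤m)
    (λ t p q → tr (mono m (g t) (l₁ (g t) (up p) (up q))) (fg⊑ t))
    (λ t p q → tr (mono m (g t) (l₂ (g t) (up p) (up q))) (fg⊑ t))
    (mono x u x≤u)
    (λ t p q → tr (⊑fg t) (mono (g t) u (glb (g t) (down p) (down q)))))
  where
  up : ∀ {s t} → f s ⊑ t → s ≤ g t
  up p = refl′ _ _ (tr p (⊑fg _))
  down : ∀ {s t} → t ⊑ f s → g t ≤ s
  down p = refl′ _ _ (tr (fg⊑ _) p)

congruenceUniform⇒semidistributive : (L : FinLattice) → CongruenceUniform L →
  FinLattice.Elt L × JoinSD (FinLattice._≤_ L) × MeetSD (FinLattice._≤_ L)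
congruenceUniform⇒semidistributive L (Q , d , iso) =
  from element ,
  joinSD-surj to from (λ y → Q.reflexive (to-from y)) (λ y → Q.reflexive (Q.Eq.sym (to-from y)))
    Q.trans to-mono to-refl joinSD ,
  joinSD-surj to from (λ y → Q.reflexive (Q.Eq.sym (to-from y))) (λ y → Q.reflexive (to-from y))
    (flip Q.trans) (λ x y → to-mono y x) (λ x y → to-refl y x) meetSD
  where
  module Q = Poset Q
  open OrderIso iso
  open SemidistributivePoset (doublings⇒semidistributive d)

-- Counting in lists without repetition

length-⊆ : ∀ {A : Set} {xs ys : List A} → Unique xs → xs ⊆ ys → length xs ≤ℕ length ys
length-⊆ {xs = []} _ _ = z≤n
length-⊆ {xs = x ∷ xs} (x∉xs ∷ u) xs⊆ys with ∈.∈-∃++ (xs⊆ys (here refl))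
... | ps , qs , refl = subst (suc (length xs) ≤ℕ_) (sym len)
        (s≤s (length-⊆ u λ {t} t∈ → drop t∈ (∈.∈-++⁻ ps (xs⊆ys (there t∈)))))
  where
  len : length (ps ++ x ∷ qs) ≡ suc (length (ps ++ qs))
  len = trans (List.length-++ ps) (trans (ℕ.+-suc _ _) (cong suc (sym (List.length-++ ps))))
  drop : ∀ {t} → t ∈ xs → t ∈ ps ⊎ t ∈ x ∷ qs → t ∈ ps ++ qs
  drop t∈ (inj₁ p)           = ∈.∈-++⁺ˡ p
  drop t∈ (inj₂ (here refl)) = ⊥-elim (All.lookup x∉xs t∈ refl)
  drop t∈ (inj₂ (there q))   = ∈.∈-++⁺ʳ ps q

∉⇒Unique-∷ : ∀ {A : Set} {x : A} {xs} → x ∉ xs → Unique xs → Unique (x ∷ xs)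
∉⇒Unique-∷ x∉ u = All.tabulate (λ t∈ e → x∉ (subst (_∈ _) (sym e) t∈)) ∷ u

module _ {n : ℕ} where
  open import Data.List.Membership.DecPropositional (Fin._≟_ {n}) public using (_∈?_)

⊆-length⇒⊇ : ∀ {n} {xs ys : List (Fin n)} →
  Unique xs → xs ⊆ ys → length ys ≤ℕ length xs → ys ⊆ xs
⊆-length⇒⊇ {xs = xs} u xs⊆ys ≤len {y} y∈ with y ∈? xs
... | yes p = p
... | no ¬p = ⊥-elim (ℕ.1+n≰n (ℕ.≤-trans (length-⊆ (∉⇒Unique-∷ ¬p u) sub) ≤len))
  where
  sub : y ∷ xs ⊆ _
  sub (here refl) = y∈
  sub (there p)   = xs⊆ys p

-- Saturated chains in a finite lattice

module Chains (K : FinLattice) where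
  open FinLattice K
  module O = IsLattice isLattice
  open O using (x≤x∨y; y≤x∨y; ∨-least; x∧y≤x; x∧y≤y; ∧-greatest) public

  ∧-comm : ∀ x y → (x ∧ y) ≡ (y ∧ x)
  ∧-comm x y = O.antisym (∧-greatest (x∧y≤y _ _) (x∧y≤x _ _)) (∧-greatest (x∧y≤y _ _) (x∧y≤x _ _))

  ∨-comm : ∀ x y → (x ∨ y) ≡ (y ∨ x)
  ∨-comm x y = O.antisym (∨-least (y≤x∨y _ _) (x≤x∨y _ _)) (∨-least (y≤x∨y _ _) (x≤x∨y _ _))

  _≟_ : (x y : Elt) → Dec (x ≡ y)
  _≟_ = Fin._≟_

  _≤?_ : ∀ x y → Dec (x ≤ y)
  x ≤? y = map′ (λ e → subst (x ≤_) e (x≤x∨y x y))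
                (λ p → O.antisym (∨-least p O.refl) (y≤x∨y x y)) ((x ∨ y) ≟ y)

  _<?_ : ∀ x y → Dec (x < y)
  x <? y = (x ≤? y) ×-dec ¬? (x ≟ y)

  ≤-<-trans : ∀ {x y z} → x ≤ y → y < z → x < z
  ≤-<-trans p (q , ne) = O.trans p q , λ { refl → ne (O.antisym q p) }

  <-≤-trans : ∀ {x y z} → x < y → y ≤ z → x < z
  <-≤-trans (p , ne) q = O.trans p q , λ { refl → ne (O.antisym p q) }

  <-trans : ∀ {x y z} → x < y → y < z → x < z
  <-trans p q = ≤-<-trans (proj₁ p) q

  <⇒≱ : ∀ {x y} → x < y → ¬ y ≤ x
  <⇒≱ (p , ne) q = ne (O.antisym p q)

  ⋖-≤ : ∀ {x y z} → x ⋖ y → x ≤ z → z ≤ y → z ≡ x ⊎ z ≡ y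
  ⋖-≤ {x} {y} {z} (_ , gap) x≤z z≤y with z ≟ x | z ≟ y
  ... | yes p | _     = inj₁ p
  ... | no _  | yes q = inj₂ q
  ... | no p  | no q  = ⊥-elim (gap z (x≤z , p ∘ sym) (z≤y , q))

  <-isStrictPartialOrder : IsStrictPartialOrder _≡_ _<_
  <-isStrictPartialOrder = record
    { isEquivalence = isEquivalence ; irrefl = λ { refl (_ , ne) → ne refl }
    ; trans = <-trans ; <-resp-≈ = resp₂ _<_ }

  <-wellFounded : WellFounded _<_
  <-wellFounded = spo-wellFounded <-isStrictPartialOrder

  >-wellFounded : WellFounded (flip _<_)
  >-wellFounded = spo-noetherian <-isStrictPartialOrder

  minimal : {P : Elt → Set} → (∀ x → Dec (P x)) → ∀ {x} → P x →
            ∃[ m ] (m ≤ x × P m × (∀ z → z < m → ¬ P z))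
  minimal {P} P? {x} = go (<-wellFounded x)
    where
    go : ∀ {x} → Acc _<_ x → P x → ∃[ m ] (m ≤ x × P m × (∀ z → z < m → ¬ P z))
    go {x} (acc rs) px with Fin.any? (λ z → (z <? x) ×-dec P? z)
    ... | no none = x , O.refl , px , λ z z<x pz → none (z , z<x , pz)
    ... | yes (z , z<x , pz) with go (rs z<x) pz
    ...   | m , m≤z , r = m , O.trans m≤z (proj₁ z<x) , r

  cover-above : ∀ {x y} → x < y → ∃[ z ] (x ⋖ z × z ≤ y)
  cover-above {x} x<y with minimal (x <?_) x<y
  ... | z , z≤y , x<z , min = z , (x<z , λ w x<w w<z → min w w<z x<w) , z≤y

  -- An inductive form of the maximal chains of `[x , y]`; `sat⇒maximalIn` and `maximalIn⇒sat` show
  -- that it agrees with `IsMaximalChainIn`.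
  data Sat : Elt → Elt → List Elt → Set where
    [-] : ∀ {x} → Sat x x (x ∷ [])
    _∷_ : ∀ {x y z c} → x ⋖ y → Sat y z c → Sat x z (x ∷ c)

  sat-exists : ∀ {x y} → x ≤ y → ∃[ c ] Sat x y c
  sat-exists {x} = go (>-wellFounded x)
    where
    go : ∀ {x y} → Acc (flip _<_) x → x ≤ y → ∃[ c ] Sat x y c
    go {x} {y} (acc rs) x≤y with x ≟ y
    ... | yes refl = _ , [-]
    ... | no ne with cover-above (x≤y , ne)
    ...   | z , x⋖z , z≤y = _ , x⋖z ∷ proj₂ (go (rs (proj₁ x⋖z)) z≤y)

  sat-first : ∀ {x y c} → Sat x y c → x ∈ c
  sat-first [-]     = here refl
  sat-first (_ ∷ _) = here refl

  sat-last : ∀ {x y c} → Sat x y c → y ∈ c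
  sat-last [-]     = here refl
  sat-last (_ ∷ s) = there (sat-last s)

  sat-≤ : ∀ {x y c} → Sat x y c → x ≤ y
  sat-≤ [-]     = O.refl
  sat-≤ (c ∷ s) = O.trans (proj₁ (proj₁ c)) (sat-≤ s)

  sat-lower : ∀ {x y c t} → Sat x y c → t ∈ c → x ≤ t
  sat-lower [-]     (here refl) = O.refl
  sat-lower (_ ∷ _) (here refl) = O.refl
  sat-lower (c ∷ s) (there p)   = O.trans (proj₁ (proj₁ c)) (sat-lower s p)

  sat-upper : ∀ {x y c t} → Sat x y c → t ∈ c → t ≤ y
  sat-upper [-]     (here refl) = O.refl
  sat-upper (c ∷ s) (here refl) = O.trans (proj₁ (proj₁ c)) (sat-≤ s)
  sat-upper (c ∷ s) (there p)   = sat-upper s p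

  sat-comparable : ∀ {x y c s t} → Sat x y c → s ∈ c → t ∈ c → s ≤ t ⊎ t ≤ s
  sat-comparable S (here refl) q with S
  ... | [-]   = inj₁ (sat-lower [-] q)
  ... | _ ∷ _ = inj₁ (sat-lower S q)
  sat-comparable S (there p) (here refl) with S
  ... | _ ∷ _ = inj₂ (sat-lower S (there p))
  sat-comparable (_ ∷ S) (there p) (there q) = sat-comparable S p q

  sat-chain : ∀ {x y c} → Sat x y c → IsChain c
  sat-chain [-]                 = [-]
  sat-chain (c ∷ [-])           = proj₁ c ∷ [-]
  sat-chain (c ∷ s@(_ ∷ _))     = proj₁ c ∷ sat-chain s

  chain-unique : ∀ {c} → IsChain c → Unique c
  chain-unique = AllPairs.map proj₂ ∘ Linked.Linked⇒AllPairs <-trans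

  sat-unique : ∀ {x y c} → Sat x y c → Unique c
  sat-unique = chain-unique ∘ sat-chain

  sat-++ : ∀ {x y z c d} → Sat x y c → Sat y z (y ∷ d) → Sat x z (c ++ d)
  sat-++ [-]     t = t
  sat-++ (p ∷ s) t = p ∷ sat-++ s t

  sat-∷ : ∀ {x y c} → Sat x y c → ∃[ d ] c ≡ x ∷ d
  sat-∷ [-]     = _ , refl
  sat-∷ (_ ∷ _) = _ , refl

  sat-comparable⇒∈ : ∀ {x y c t} → Sat x y c → x ≤ t → t ≤ y →
                     (∀ s → s ∈ c → s ≤ t ⊎ t ≤ s) → t ∈ c
  sat-comparable⇒∈ [-] x≤t t≤y _ = here (O.antisym t≤y x≤t)
  sat-comparable⇒∈ {x} {t = t} (c ∷ s) x≤t t≤y cmp with cmp _ (there (sat-first s))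
  ... | inj₁ x′≤t = there (sat-comparable⇒∈ s x′≤t t≤y (λ r → cmp r ∘ there))
  ... | inj₂ t≤x′ with ⋖-≤ c x≤t t≤x′
  ...   | inj₁ refl = here refl
  ...   | inj₂ refl = there (sat-first s)

  chain-comparable : ∀ {c s t} → IsChain c → s ∈ c → t ∈ c → s ≤ t ⊎ t ≤ s
  chain-comparable ch = go (Linked.Linked⇒AllPairs <-trans ch)
    where
    go : ∀ {c s t} → AllPairs _<_ c → s ∈ c → t ∈ c → s ≤ t ⊎ t ≤ s
    go (_ ∷ _)  (here refl) (here refl) = inj₁ O.refl
    go (a ∷ _)  (here refl) (there q)   = inj₁ (proj₁ (All.lookup a q))
    go (a ∷ _)  (there p)   (here refl) = inj₂ (proj₁ (All.lookup a p))
    go (_ ∷ ps) (there p)   (there q)   = go ps p q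

  chain-insert : ∀ {c} t → IsChain c → (∀ s → s ∈ c → s ≤ t ⊎ t ≤ s) →
    ∃[ d ] (IsChain d × c ⊆ d × t ∈ d × (∀ s → s ∈ d → s ≡ t ⊎ s ∈ c))
  chain-insert {c} t ch cmp with go (Linked.Linked⇒AllPairs <-trans ch) cmp
    where
    go : ∀ {c} → AllPairs _<_ c → (∀ s → s ∈ c → s ≤ t ⊎ t ≤ s) →
         ∃[ d ] (AllPairs _<_ d × c ⊆ d × t ∈ d × (∀ s → s ∈ d → s ≡ t ⊎ s ∈ c))
    go [] _ = t ∷ [] , [] ∷ [] , (λ ()) , here refl , λ { s (here e) → inj₁ e }
    go {h ∷ c} (a ∷ ps) cmp with h ≟ t
    ... | yes refl = h ∷ c , a ∷ ps , id , here refl , λ s → inj₂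
    ... | no ne with cmp h (here refl)
    ...   | inj₂ t≤h = t ∷ h ∷ c , (t<h ∷ All.map (<-trans t<h) a) ∷ a ∷ ps , there , here refl ,
                       λ { s (here e) → inj₁ e ; s (there p) → inj₂ p }
      where t<h = t≤h , ne ∘ sym
    ...   | inj₁ h≤t with go ps (λ s → cmp s ∘ there)
    ...     | d , ps′ , sub , t∈ , back =
      h ∷ d , All.tabulate (λ {s} s∈ → above s (back s s∈)) ∷ ps′ ,
      (λ { (here e) → here e ; (there p) → there (sub p) }) , there t∈ ,
      λ { s (here e) → inj₂ (here e) ; s (there p) → map₂ there (back s p) }
      where
      above : ∀ s → s ≡ t ⊎ s ∈ c → h < s
      above s (inj₁ refl) = h≤t , ne
      above s (inj₂ p)    = All.lookup a p
  ... | d , ps , r = d , Linked.AllPairs⇒Linked ps , r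

  maximal-comparable⇒∈ : ∀ {S c t} → IsMaximalChainIn S c → S t →
                         (∀ s → s ∈ c → s ≤ t ⊎ t ≤ s) → t ∈ c
  maximal-comparable⇒∈ {S} {t = t} (ch , Sc , max) St cmp with chain-insert t ch cmp
  ... | d , ch′ , sub , t∈ , back =
    max d ch′ (All.tabulate (λ {s} s∈ → [ (λ { refl → St }) , All.lookup Sc ] (back s s∈))) sub t∈

  sat⇒maximalIn : ∀ {x y c} → Sat x y c → IsMaximalChainIn (Interval x y) c
  sat⇒maximalIn s = sat-chain s , All.tabulate (λ t∈ → sat-lower s t∈ , sat-upper s t∈) ,
    λ ys ch S sub t∈ → let x≤t , t≤y = All.lookup S t∈ in
      sat-comparable⇒∈ s x≤t t≤y (λ r r∈ → chain-comparable ch (sub r∈) t∈)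

  private
    -- A tail of the chain is no longer maximal in the original interval, so the recursion passes on
    -- only this: elements between the head and `y` that are comparable to the whole chain belong to
    -- it.
    fromHead : ∀ {y h c} → IsChain (h ∷ c) → (∀ t → t ∈ h ∷ c → t ≤ y) → y ∈ h ∷ c →
      (∀ t → h ≤ t → t ≤ y → (∀ s → s ∈ h ∷ c → s ≤ t ⊎ t ≤ s) → t ∈ h ∷ c) →
      Sat h y (h ∷ c)
    fromHead {c = []} _ _ (here refl) _ = [-]
    fromHead {y} {h} {k ∷ c} (h<k ∷ ch) ub y∈ sat = (h<k , gap) ∷ fromHead ch (λ t → ub t ∘ there) y∈′ sat′
      where
      tail : ∀ t → h < t → t ∈ h ∷ k ∷ c → t ∈ k ∷ c
      tail t h<t (here refl) = ⊥-elim (proj₂ h<t refl)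
      tail t h<t (there p)   = p
      above : ∀ s → s ∈ k ∷ c → k ≤ s
      above s (here refl) = O.refl
      above s (there p) with Linked.Linked⇒AllPairs <-trans ch
      ... | a ∷ _ = proj₁ (All.lookup a p)
      y∈′ : y ∈ k ∷ c
      y∈′ = tail y (<-≤-trans h<k (ub k (there (here refl)))) y∈
      sat′ : ∀ t → k ≤ t → t ≤ y → (∀ s → s ∈ k ∷ c → s ≤ t ⊎ t ≤ s) → t ∈ k ∷ c
      sat′ t k≤t t≤y cmp = tail t (<-≤-trans h<k k≤t)
        (sat t (proj₁ (<-≤-trans h<k k≤t)) t≤y
          λ { s (here refl) → inj₁ (proj₁ (<-≤-trans h<k k≤t)) ; s (there p) → cmp s p })
      gap : ∀ z → h < z → z < k → ⊥
      gap z h<z z<k = <⇒≱ z<k (above z (tail z h<z (sat z (proj₁ h<z)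
        (O.trans (proj₁ z<k) (ub k (there (here refl))))
        λ { s (here refl) → inj₁ (proj₁ h<z) ; s (there p) → inj₂ (O.trans (proj₁ z<k) (above s p)) })))

  maximalIn⇒sat : ∀ {x y c} → x ≤ y → IsMaximalChainIn (Interval x y) c → Sat x y c
  maximalIn⇒sat {x} {y} {c} x≤y M@(ch , bounds , _) = go c M x∈ y∈
    where
    x∈ : x ∈ c
    x∈ = maximal-comparable⇒∈ M (O.refl , x≤y) (λ s s∈ → inj₂ (proj₁ (All.lookup bounds s∈)))
    y∈ : y ∈ c
    y∈ = maximal-comparable⇒∈ M (x≤y , O.refl) (λ s s∈ → inj₁ (proj₂ (All.lookup bounds s∈)))
    go : ∀ c → IsMaximalChainIn (Interval x y) c → x ∈ c → y ∈ c → Sat x y c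
    go (h ∷ c) M@(ch , (x≤h , h≤y) ∷ S , _) x∈ y∈ with Linked.Linked⇒AllPairs <-trans ch | x∈
    ... | a ∷ _ | there p = ⊥-elim (<⇒≱ (All.lookup a p) x≤h)
    ... | _     | here refl =
      fromHead ch (λ { t (here refl) → h≤y ; t (there p) → proj₂ (All.lookup S p) }) y∈
        (λ t h≤t t≤y cmp → maximal-comparable⇒∈ M (h≤t , t≤y) cmp)

  -- A vertex with its two neighbours: the spot where consecutive labels are compared and where a
  -- single vertex can be exchanged.
  data Place (u v w : Elt) : List Elt → Set where
    here  : ∀ {c} → Place u v w (u ∷ v ∷ w ∷ c)
    there : ∀ {x c} → Place u v w c → Place u v w (x ∷ c)

  place-∈ : ∀ {u v w c} → Place u v w c → u ∈ c × v ∈ c × w ∈ c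
  place-∈ here      = here refl , there (here refl) , there (there (here refl))
  place-∈ (there p) = let a , b , c = place-∈ p in there a , there b , there c

  sat-place : ∀ {x y c u v w} → Sat x y c → Place u v w c → u ⋖ v × v ⋖ w
  sat-place (p ∷ q ∷ [-])     here = p , q
  sat-place (p ∷ q ∷ (_ ∷ _)) here = p , q
  sat-place (_ ∷ s) (there pl)     = sat-place s pl

  places? : {Q R : Elt → Elt → Elt → Set} → (∀ u v w → Q u v w ⊎ R u v w) → ∀ c →
    (∀ {u v w} → Place u v w c → Q u v w) ⊎ ∃[ u ] ∃[ v ] ∃[ w ] (Place u v w c × R u v w)
  places? d []           = inj₁ λ ()
  places? d (_ ∷ [])     = inj₁ λ { (there ()) }
  places? d (_ ∷ _ ∷ []) = inj₁ λ { (there (there ())) }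
  places? d (u ∷ v ∷ w ∷ c) with d u v w | places? d (v ∷ w ∷ c)
  ... | inj₂ r | _ = inj₂ (u , v , w , here , r)
  ... | inj₁ _ | inj₂ (u′ , v′ , w′ , p , r) = inj₂ (u′ , v′ , w′ , there p , r)
  ... | inj₁ q | inj₁ qs = inj₁ λ { here → q ; (there p) → qs p }

  sat-neighbours : ∀ {x y c v} → Sat x y c → v ∈ c → v ≢ x → v ≢ y → ∃₂ λ u w → Place u v w c
  sat-neighbours [-]     (here refl) v≢x _ = ⊥-elim (v≢x refl)
  sat-neighbours (_ ∷ _) (here refl) v≢x _ = ⊥-elim (v≢x refl)
  sat-neighbours {v = v} (_∷_ {y = x′} _ s) (there p) v≢x v≢y with v ≟ x′
  ... | no ne = let u , w , pl = sat-neighbours s p ne v≢y in u , w , there pl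
  ... | yes refl with s
  ...   | [-]           = ⊥-elim (v≢y refl)
  ...   | _ ∷ [-]       = _ , _ , here
  ...   | _ ∷ (_ ∷ _)   = _ , _ , here

  sat-step : ∀ {x y c j} → Sat x y c → ¬ j ≤ x → j ≤ y →
             ∃₂ λ u v → u ∈ c × v ∈ c × u ⋖ v × ¬ j ≤ u × j ≤ v
  sat-step [-] j≰ j≤ = ⊥-elim (j≰ j≤)
  sat-step {x} {j = j} (_∷_ {y = x′} p s) j≰ j≤ with j ≤? x′
  ... | yes q = x , x′ , here refl , there (sat-first s) , p , j≰ , q
  ... | no q  = let u , v , u∈ , v∈ , r = sat-step s q j≤ in u , v , there u∈ , there v∈ , r

-- Join-irreducibles seen by a chain

module Bounded (K : FinLattice) (e : FinLattice.Elt K) where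
  open FinLattice K
  open Chains K

  -- The element `e` seeds the folds, because a `FinLattice` may be empty.
  bot top : Elt
  bot = foldr _∧_ e (allFin n)
  top = foldr _∨_ e (allFin n)

  bot-min : ∀ x → bot ≤ x
  bot-min x = go (allFin n) (∈.∈-allFin x)
    where
    go : ∀ xs → x ∈ xs → foldr _∧_ e xs ≤ x
    go (y ∷ xs) (here refl) = x∧y≤x _ _
    go (y ∷ xs) (there p)   = O.trans (x∧y≤y _ _) (go xs p)

  top-max : ∀ x → x ≤ top
  top-max x = go (allFin n) (∈.∈-allFin x)
    where
    go : ∀ xs → x ∈ xs → x ≤ foldr _∨_ e xs
    go (y ∷ xs) (here refl) = x≤x∨y _ _
    go (y ∷ xs) (there p)   = O.trans (go xs p) (y≤x∨y _ _)

  maximal⇒sat : ∀ {F} → IsMaximalChain F → Sat bot top F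
  maximal⇒sat (ch , _ , max) = maximalIn⇒sat (bot-min top)
    (ch , All.tabulate (λ {t} _ → bot-min t , top-max t) , λ ys ch′ _ → max ys ch′ (All.tabulate λ _ → tt))

  sat⇒maximal : ∀ {F} → Sat bot top F → IsMaximalChain F
  sat⇒maximal s = let ch , _ , max = sat⇒maximalIn s in
    ch , All.tabulate (λ _ → tt) , λ ys ch′ _ → max ys ch′ (All.tabulate (λ {t} _ → bot-min t , top-max t))

  -- For j join-irreducible with lower cover j*, this says j* ≤ s and j ≰ s.
  Seen : Elt → Elt → Set
  Seen j s = ¬ j ≤ s × (∀ z → z < j → z ≤ s)

  -- By `ji⇒seen` and `seen⇒ji`, the `j` for which some `s` satisfies `Seen j s` are precisely the
  -- join-irreducibles.
  Sees : List Elt → Set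
  Sees F = ∀ j s → Seen j s → ∃[ x ] (x ∈ F × Seen j x)

  -- `j ∧ t` differs from `j`, so it lies below the lower cover of `j`.
  seen-∧ : ∀ {j s t} → Seen j s → ¬ j ≤ t → (j ∧ t) ≤ s
  seen-∧ (_ , below) j≰t = below _ (x∧y≤x _ _ , λ eq → j≰t (subst (_≤ _) eq (x∧y≤y _ _)))

  seen-up : ∀ {j s t} → Seen j s → s ≤ t → ¬ j ≤ t → Seen j t
  seen-up (_ , below) s≤t j≰t = j≰t , λ z z<j → O.trans (below z z<j) s≤t

  cover-below : ∀ {z j} → z < j → ∃[ w ] (z ≤ w × w ⋖ j)
  cover-below z<j with sat-exists (proj₁ z<j)
  ... | _ , S with sat-step S (<⇒≱ z<j) O.refl
  ...   | u , v , u∈ , v∈ , u⋖v , _ , j≤v with O.antisym (sat-upper S v∈) j≤v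
  ...     | refl = u , sat-lower S u∈ , u⋖v

  ji⇒seen : ∀ {j} → JoinIrreducible j → ∃[ s ] Seen j s
  ji⇒seen (y , y⋖j , uniq) = y , <⇒≱ (proj₁ y⋖j) , λ z z<j →
    let w , z≤w , w⋖j = cover-below z<j in subst (z ≤_) (uniq w w⋖j) z≤w

  -- The lower cover is `j ∧ s`: whatever is strictly below `j` is below `s`, hence below this meet.
  seen⇒ji : ∀ {j s} → Seen j s → JoinIrreducible j
  seen⇒ji {j} {s} σ@(j≰s , below) = j ∧ s , (y<j , gap) , uniq
    where
    y<j : (j ∧ s) < j
    y<j = x∧y≤x _ _ , λ eq → j≰s (subst (_≤ s) eq (x∧y≤y _ _))
    z≤y : ∀ z → z < j → z ≤ (j ∧ s)
    z≤y z z<j = ∧-greatest (proj₁ z<j) (below z z<j)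
    gap : ∀ z → (j ∧ s) < z → z < j → ⊥
    gap z y<z z<j = <⇒≱ y<z (z≤y z z<j)
    uniq : ∀ z → z ⋖ j → z ≡ (j ∧ s)
    uniq z z⋖j with ⋖-≤ z⋖j (z≤y z (proj₁ z⋖j)) (proj₁ y<j)
    ... | inj₁ eq = sym eq
    ... | inj₂ eq = ⊥-elim (proj₂ y<j eq)

  private
    -- A minimal element among those below `y` and not below `x` qualifies. This supplies the
    -- join-irreducibles that separate elements and label steps.
    minimalNotBelow : ∀ {x y} → ¬ y ≤ x → ∃[ j ] (j ≤ y × Seen j x)
    minimalNotBelow {x} {y} y≰x
      with minimal (λ z → (z ≤? y) ×-dec ¬? (z ≤? x)) (O.refl , y≰x)
    ... | j , _ , (j≤y , j≰x) , min = j , j≤y , j≰x , λ z z<j →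
      decidable-stable (z ≤? x) λ z≰x → min z z<j (O.trans (proj₁ z<j) j≤y , z≰x)

  sdj : JoinSD _≤_ → ∀ {x y z m} → x ≤ m → y ≤ m → z ≤ m → m ≤ (x ∨ y) → m ≤ (x ∨ z) → m ≤ (x ∨ (y ∧ z))
  sdj sd {x} {y} {z} {m} x≤m y≤m z≤m p q = sd x y z m _ x≤m y≤m z≤m
    (λ t r s → O.trans p (∨-least r s)) (λ t r s → O.trans q (∨-least r s))
    (x≤x∨y _ _) (λ t r s → O.trans (∧-greatest r s) (y≤x∨y _ _))

  sdm : MeetSD _≤_ → ∀ {x y z m} → m ≤ x → m ≤ y → m ≤ z → (x ∧ y) ≤ m → (x ∧ z) ≤ m → (x ∧ (y ∨ z)) ≤ m
  sdm sd {x} {y} {z} {m} m≤x m≤y m≤z p q = sd x y z m _ m≤x m≤y m≤z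
    (λ t r s → O.trans (∧-greatest r s) p) (λ t r s → O.trans (∧-greatest r s) q)
    (x∧y≤x _ _) (λ t r s → O.trans (x∧y≤y _ _) (∨-least r s))

  cover-∨ : ∀ {u v j} → u ⋖ v → j ≤ v → ¬ j ≤ u → v ≤ (u ∨ j)
  cover-∨ u⋖v j≤v j≰u with ⋖-≤ u⋖v (x≤x∨y _ _) (∨-least (proj₁ (proj₁ u⋖v)) j≤v)
  ... | inj₁ eq = ⊥-elim (j≰u (subst (_ ≤_) eq (y≤x∨y _ _)))
  ... | inj₂ eq = O.reflexive (sym eq)

  -- If `q ≤ p` fails, some `j ≤ q` is not below `p` while its lower cover is. A vertex `x′ ≥ a` of
  -- `F` sees `j`, so `j ∧ x′` and `j ∧ p` are both the lower cover of `j`. By meet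
  -- semidistributivity so is `j ∧ (x′ ∨ p)`, although `j ≤ q ≤ b ∨ a ≤ x′ ∨ p`.
  sees⇒leftModular : MeetSD _≤_ → ∀ {F a} → Sat bot top F → Sees F → a ∈ F → LeftModularElement a
  sees⇒leftModular sd {F} {a} S sees a∈ b c b<c = O.antisym (decidable-stable (q ≤? p) absurd) p≤q
    where
    p q : Elt
    p = b ∨ (a ∧ c)
    q = (b ∨ a) ∧ c
    p≤q : p ≤ q
    p≤q = ∨-least (∧-greatest (x≤x∨y _ _) (proj₁ b<c))
                  (∧-greatest (O.trans (x∧y≤x _ _) (y≤x∨y _ _)) (x∧y≤y _ _))
    absurd : ¬ ¬ q ≤ p
    absurd q≰p with minimalNotBelow q≰p
    ... | j , j≤q , σ@(j≰p , _) with sees j p σ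
    ...   | x , x∈ , τ = finish (above (sat-comparable S x∈ a∈))
      where
      above : x ≤ a ⊎ a ≤ x → ∃[ x′ ] (a ≤ x′ × Seen j x′)
      above (inj₂ a≤x) = x , a≤x , τ
      -- A vertex below `a` can be traded for `a`: `j ≤ a` together with `j ≤ c` would put `j` below
      -- `p`.
      above (inj₁ x≤a) = a , O.refl , seen-up τ x≤a λ j≤a →
        j≰p (O.trans (∧-greatest j≤a (O.trans j≤q (x∧y≤y _ _))) (y≤x∨y _ _))
      finish : ∃[ x′ ] (a ≤ x′ × Seen j x′) → ⊥
      finish (x′ , a≤x′ , υ@(j≰x′ , _)) = j≰p (O.trans (O.trans (∧-greatest O.refl j≤x′∨p)
          (sdm sd (x∧y≤x j p) (seen-∧ υ j≰p) (x∧y≤y j p) (∧-greatest (x∧y≤x _ _) (seen-∧ σ j≰x′)) O.refl))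
          (x∧y≤y _ _))
        where
        j≤x′∨p : j ≤ (x′ ∨ p)
        j≤x′∨p = O.trans j≤q (O.trans (x∧y≤x _ _)
          (∨-least (O.trans (x≤x∨y _ _) (y≤x∨y _ _)) (O.trans a≤x′ (x≤x∨y _ _))))

  -- Let `u ⋖ v` be the step at which the chain rises above `j`, and `y = j ∧ s` the lower cover of
  -- `j`. If `y ≰ u`, then `y ∨ u = v ≥ j`, so left modularity of `u` gives `j = y ∨ (u ∧ j)`, while
  -- `u ∧ j ≤ y`.
  leftModular⇒sees : ∀ {F} → Sat bot top F → All LeftModularElement F → Sees F
  leftModular⇒sees S lm j s σ@(j≰s , below)
    with sat-step S (λ j≤bot → j≰s (O.trans j≤bot (bot-min s))) (top-max j)
  ... | u , v , u∈ , _ , u⋖v , j≰u , j≤v = u , u∈ , j≰u , λ z z<j → O.trans (∧-greatest (proj₁ z<j) (below z z<j)) y≤u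
    where
    y : Elt
    y = j ∧ s
    y<j : y < j
    y<j = x∧y≤x _ _ , λ eq → j≰s (subst (_≤ s) eq (x∧y≤y _ _))
    y≤u : y ≤ u
    y≤u with ⋖-≤ u⋖v (y≤x∨y y u) (∨-least (O.trans (x∧y≤x _ _) j≤v) (proj₁ (proj₁ u⋖v)))
    ... | inj₁ eq = subst (y ≤_) eq (x≤x∨y _ _)
    ... | inj₂ eq = ⊥-elim (<⇒≱ y<j (O.trans
      (subst (j ≤_) (All.lookup lm u∈ y j y<j) (∧-greatest (subst (j ≤_) (sym eq) j≤v) O.refl))
      (∨-least O.refl (∧-greatest (x∧y≤y _ _) (O.trans (O.reflexive (∧-comm u j)) (seen-∧ σ j≰u))))))

  -- Labelling the steps of a chain by join-irreducibles

  data Labels : List Elt → List Elt → Set where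
    []  : ∀ {x} → Labels (x ∷ []) []
    _∷_ : ∀ {x y j c js} → j ≤ y × Seen j x → Labels (y ∷ c) js → Labels (x ∷ y ∷ c) (j ∷ js)

  labels-exist : ∀ {x c} → IsChain (x ∷ c) → ∃[ js ] Labels (x ∷ c) js
  labels-exist [-]        = [] , []
  labels-exist (x<y ∷ ch) =
    let j , l = minimalNotBelow (<⇒≱ x<y) ; js , ls = labels-exist ch in j ∷ js , l ∷ ls

  labels-length : ∀ {c js} → Labels c js → length c ≡ suc (length js)
  labels-length []       = refl
  labels-length (_ ∷ ls) = cong suc (labels-length ls)

  labels-seen : ∀ {c js j} → Labels c js → j ∈ js → ∃[ s ] (s ∈ c × Seen j s)
  labels-seen ((_ , σ) ∷ _) (here refl) = _ , here refl , σ
  labels-seen (_ ∷ ls)      (there p)   = let s , s∈ , σ = labels-seen ls p in s , there s∈ , σ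

  labels-≰ : ∀ {x c js j} → IsChain (x ∷ c) → Labels (x ∷ c) js → j ∈ js → ¬ j ≤ x
  labels-≰ _          ((_ , σ) ∷ _) (here refl) = proj₁ σ
  labels-≰ (x<y ∷ ch) (_ ∷ ls)      (there p)   = λ j≤x → labels-≰ ch ls p (O.trans j≤x (proj₁ x<y))

  labels-unique : ∀ {x c js} → IsChain (x ∷ c) → Labels (x ∷ c) js → Unique js
  labels-unique _        []               = []
  labels-unique (_ ∷ ch) ((j≤y , _) ∷ ls) = ∉⇒Unique-∷ (λ j∈ → labels-≰ ch ls j∈ j≤y) (labels-unique ch ls)

  -- Both `x ∨ j` and `x ∨ k` equal `y`, so join semidistributivity gives `y ≤ x ∨ (j ∧ k)` and
  -- hence `j ∧ k ≰ x`. As everything strictly below `j` or `k` is below `x`, the meet equals both.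
  step-label-unique : JoinSD _≤_ → ∀ {x y j k} → x ⋖ y → j ≤ y → Seen j x → k ≤ y → Seen k x → j ≡ k
  step-label-unique sd {x} {y} {j} {k} x⋖y j≤y σ k≤y τ =
    trans (sym (collapse σ (x∧y≤x j k))) (collapse τ (x∧y≤y j k))
    where
    j∧k≰x : ¬ (j ∧ k) ≤ x
    j∧k≰x le = <⇒≱ (proj₁ x⋖y) (O.trans (sdj sd (proj₁ (proj₁ x⋖y)) j≤y k≤y
      (cover-∨ x⋖y j≤y (proj₁ σ)) (cover-∨ x⋖y k≤y (proj₁ τ))) (∨-least O.refl le))
    collapse : ∀ {l} → Seen l x → (j ∧ k) ≤ l → (j ∧ k) ≡ l
    collapse {l} (_ , below) le = decidable-stable ((j ∧ k) ≟ l) λ ne → j∧k≰x (below _ (le , ne))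

  -- The vertex just before the chain rises above `j` still sees `j` by `seen-up`, and the label of
  -- that step is unique.
  labels-complete : JoinSD _≤_ → ∀ {x y c js j s} → Sat x y c → Labels c js →
    Seen j s → s ∈ c → ¬ j ≤ x → j ≤ y → j ∈ js
  labels-complete sd [-] [] _ _ j≰x j≤y = ⊥-elim (j≰x j≤y)
  labels-complete sd {j = j} (p ∷ S) (l ∷ ls) σ s∈ j≰x j≤y with sat-∷ S
  ... | _ , refl with j ≤? _ | s∈
  ...   | yes j≤x′ | here refl = here (step-label-unique sd p j≤x′ σ (proj₁ l) (proj₂ l))
  ...   | yes j≤x′ | there s∈′ = ⊥-elim (proj₁ σ (O.trans j≤x′ (sat-lower S s∈′)))
  ...   | no j≰x′  | here refl =
    there (labels-complete sd S ls (seen-up σ (proj₁ (proj₁ p)) j≰x′) (here refl) j≰x′ j≤y)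
  ...   | no j≰x′  | there s∈′ = there (labels-complete sd S ls σ s∈′ j≰x′ j≤y)

  -- The labels inject the steps of a chain into the join-irreducibles.
  chain-length-≤ : ∀ {k c} → HasCount JoinIrreducible k → IsChain c → length c ≤ℕ suc k
  chain-length-≤ {c = []} _ _ = z≤n
  chain-length-≤ {c = x ∷ c} (xs , _ , mem , refl) ch with labels-exist ch
  ... | js , ls rewrite labels-length ls =
    s≤s (length-⊆ (labels-unique ch ls) λ j∈ → proj₁ (mem _) (seen⇒ji (proj₂ (proj₂ (labels-seen ls j∈)))))

  sees⇒count : JoinSD _≤_ → ∀ {F} → Sat bot top F → Sees F → HasCount JoinIrreducible (length F ∸ 1)
  sees⇒count sd S sees with sat-∷ S
  ... | _ , refl with labels-exist (sat-chain S)
  ...   | js , ls = js , labels-unique (sat-chain S) ls ,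
    (λ j → mem j , λ j∈ → seen⇒ji (proj₂ (proj₂ (labels-seen ls j∈)))) , sym (cong (_∸ 1) (labels-length ls))
    where
    mem : ∀ j → JoinIrreducible j → j ∈ js
    mem j ji with ji⇒seen ji
    ... | s , σ with sees j s σ
    ...   | t , t∈ , τ = labels-complete sd S ls τ t∈
      (λ j≤bot → proj₁ σ (O.trans j≤bot (bot-min s))) (top-max j)

  longest⇒maximal : ∀ {ℓ c} → IsChain c → length c ≡ suc ℓ → (∀ xs → IsChain xs → length xs ≤ℕ suc ℓ) →
                    IsMaximalChain c
  longest⇒maximal ch len max = ch , All.tabulate (λ _ → tt) , λ ys ch′ _ sub →
    ⊆-length⇒⊇ (chain-unique ch) sub (subst (length ys ≤ℕ_) (sym len) (max ys ch′))

  -- A longest chain has `ℓ` distinct labels among `ℓ` join-irreducibles, so all of them occur, and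
  -- each is seen by the lower end of its step.
  extremal⇒sees : Extremal → ∃[ F ] (Sat bot top F × Sees F)
  extremal⇒sees (ℓ , ((x ∷ c , ch , len) , max) , (xs , _ , mem , refl) , _) =
    x ∷ c , maximal⇒sat (longest⇒maximal ch len max) , sees
    where
    js : List Elt
    js = proj₁ (labels-exist ch)
    ls : Labels (x ∷ c) js
    ls = proj₂ (labels-exist ch)
    sees : Sees (x ∷ c)
    sees j s σ = labels-seen ls (⊆-length⇒⊇ (labels-unique ch ls)
      (λ j∈ → proj₁ (mem _) (seen⇒ji (proj₂ (proj₂ (labels-seen ls j∈)))))
      (ℕ.≤-reflexive (ℕ.suc-injective (trans (sym len) (labels-length ls))))
      (proj₁ (mem j) (seen⇒ji σ)))

  -- Exchanging one vertex of a maximal chain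

  -- Suppose `v ∉ F′`, with neighbours `u` and `w` in `F`. If `j ≰ w`, then `w` sees `j`. Otherwise
  -- let `y ⋖ y′` be the step at which `F′` rises above `j`. Then `u ≤ y ≤ w`, join
  -- semidistributivity gives `y ≤ v`, and so `y = u`; this vertex sees `j`.
  sees-exchange : JoinSD _≤_ → ∀ {F F′ v j} → Sat bot top F → Sat bot top F′ → v ∈ F → Seen j v →
    (∀ {u} → u ∈ F → u ≢ v → u ∈ F′) → ∃[ x ] (x ∈ F′ × Seen j x)
  sees-exchange sd {F} {F′} {v} {j} S S′ v∈ σ sub with v ∈? F′
  ... | yes v∈′ = v , v∈′ , σ
  ... | no v∉′
    with sat-neighbours S v∈ (λ { refl → v∉′ (sat-first S′) }) (λ { refl → v∉′ (sat-last S′) })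
  ...   | u , w , pl with sat-place S pl | place-∈ pl | j ≤? w
  ...     | u⋖v , v⋖w | u∈ , _ , w∈ | no j≰w =
    w , sub w∈ (proj₂ (proj₁ v⋖w) ∘ sym) , seen-up σ (proj₁ (proj₁ v⋖w)) j≰w
  ...     | u⋖v , v⋖w | u∈ , _ , w∈ | yes j≤w
    with sat-step S′ (λ j≤bot → proj₁ σ (O.trans j≤bot (bot-min v))) (top-max j)
  ...       | y , y′ , y∈ , y′∈ , y⋖y′ , j≰y , j≤y′ = u , u∈′ , j≰u , below
    where
    u∈′ : u ∈ F′
    u∈′ = sub u∈ (proj₂ (proj₁ u⋖v))
    w∈′ : w ∈ F′
    w∈′ = sub w∈ (proj₂ (proj₁ v⋖w) ∘ sym)
    j≰u : ¬ j ≤ u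
    j≰u j≤u = proj₁ σ (O.trans j≤u (proj₁ (proj₁ u⋖v)))
    u≤y : u ≤ y
    u≤y with sat-comparable S′ u∈′ y∈ | sat-comparable S′ u∈′ y′∈
    ... | inj₁ p | _ = p
    ... | inj₂ _ | inj₂ y′≤u = ⊥-elim (j≰u (O.trans j≤y′ y′≤u))
    ... | inj₂ p | inj₁ q with ⋖-≤ y⋖y′ p q
    ...   | inj₁ refl = O.refl
    ...   | inj₂ refl = ⊥-elim (j≰u j≤y′)
    y≤w : y ≤ w
    y≤w = [ id , (λ w≤y → ⊥-elim (j≰y (O.trans j≤w w≤y))) ] (sat-comparable S′ y∈ w∈′)
    y∨v≡ : (y ∨ v) ≡ v ⊎ (y ∨ v) ≡ w
    y∨v≡ = ⋖-≤ v⋖w (y≤x∨y _ _) (∨-least y≤w (proj₁ (proj₁ v⋖w)))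
    y≤v : y ≤ v
    y≤v = [ (λ eq → subst (y ≤_) eq (x≤x∨y _ _)) , (λ eq → ⊥-elim (<⇒≱ (proj₁ v⋖w) (w≤v eq))) ] y∨v≡
      where
      -- If `y ∨ v = w = j ∨ v`, semidistributivity gives `w = v ∨ (j ∧ y)`, but `j ∧ y ≤ v` because
      -- `v` sees `j`.
      w≤v : (y ∨ v) ≡ w → w ≤ v
      w≤v eq = O.trans (sdj sd (proj₁ (proj₁ v⋖w)) j≤w y≤w (cover-∨ v⋖w j≤w (proj₁ σ))
          (O.trans (O.reflexive (sym eq)) (∨-least (y≤x∨y _ _) (x≤x∨y _ _))))
        (∨-least O.refl (seen-∧ σ j≰y))
    y≡u : y ≡ u
    y≡u = [ id , (λ { refl → ⊥-elim (v∉′ y∈) }) ] (⋖-≤ u⋖v u≤y y≤v)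
    -- If `z ≰ u`, then `u ∨ z = v`, which puts `v` between `y` and `y′`; yet `v` is neither of
    -- them, being different from `u` and outside `F′`.
    below : ∀ z → z < j → z ≤ u
    below z z<j = decidable-stable (z ≤? u) λ z≰u →
      [ (λ v≡y → proj₂ (proj₁ u⋖v) (sym (trans v≡y y≡u))) , (λ { refl → v∉′ y′∈ }) ]
        (⋖-≤ y⋖y′ y≤v (O.trans (cover-∨ u⋖v (proj₂ σ z z<j) z≰u)
          (∨-least (O.trans u≤y (proj₁ (proj₁ y⋖y′))) (O.trans (proj₁ z<j) j≤y′))))

-- Shellings and their first facet

module Shellings (K : FinLattice) (e : FinLattice.Elt K) where
  open FinLattice K
  open Chains K
  open Bounded K e
  open import Data.List.Extrema.Nat using (argmax; argmax-sel; f[xs]≤f[argmax]; f[⊥]≤f[argmax])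

  -- `F` without `v` is contained in `H`, so it is a face of the intersection; it contains `G`, and
  -- maximality makes the two equal as sets.
  facet-size : ∀ {pre F G v H} → Unique F → ShellFace pre F G →
    (∀ G′ → ShellFace pre F G′ → G ⊆ G′ → G′ ⊆ G) → v ∈ F → v ∉ G →
    H ∈ pre → (∀ {t} → t ∈ F → t ≢ v → t ∈ H) → length G ≡ length F ∸ 1
  facet-size {pre} {F} {G} {v} uniq (G-unique , G⊆F , _) maximal v∈F v∉G H∈pre sub =
    cong (_∸ 1) (ℕ.≤-antisym
      (length-⊆ (∉⇒Unique-∷ v∉G G-unique) λ { (here refl) → v∈F ; (there t∈) → G⊆F t∈ })
      (length-⊆ uniq F⊆))
    where
    ≢v? : ∀ t → Dec (t ≢ v)
    ≢v? t = ¬? (t ≟ v)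
    F∖v⊆G : filter ≢v? F ⊆ G
    F∖v⊆G = maximal (filter ≢v? F)
      (Unique.filter⁺ ≢v? uniq , proj₁ ∘ ∈.∈-filter⁻ ≢v? ,
        lose H∈pre (λ t∈ → let t∈F , t≢v = ∈.∈-filter⁻ ≢v? {xs = F} t∈ in sub t∈F t≢v))
      (λ t∈ → ∈.∈-filter⁺ ≢v? (G⊆F t∈) λ { refl → v∉G t∈ })
    F⊆ : F ⊆ v ∷ G
    F⊆ {t} t∈ with t ≟ v
    ... | yes refl = here refl
    ... | no t≢v   = there (F∖v⊆G (∈.∈-filter⁺ ≢v? t∈ t≢v))

  -- The face F ∩ Fᵢ with Fᵢ an earlier facet chosen to make it as large as
  -- possible is a facet of the intersection, so it omits only one vertex of F.
  large-intersection : ∀ {P pre F} → Unique F →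
    PureOfDim (ShellFace (P ∷ pre) F) (length F ∸ 1) →
    ∃[ Fi ] (Fi ∈ P ∷ pre × (∀ {u v} → v ∈ F → v ∉ Fi → u ∈ F → u ≢ v → u ∈ Fi))
  large-intersection {P} {pre} {F} uniq pure = Fi , Fi∈ , λ {u} {v} → other u v
    where
    common : List Elt → List Elt
    common H = filter (_∈? H) F
    size : List Elt → ℕ
    size = length ∘ common
    Fi : List Elt
    Fi = argmax size P pre
    Fi∈ : Fi ∈ P ∷ pre
    Fi∈ = Any.fromSum (argmax-sel size P pre)
    size-max : ∀ {H} → H ∈ P ∷ pre → size H ≤ℕ size Fi
    size-max (here refl) = f[⊥]≤f[argmax] {f = size} P pre
    size-max (there p)   = All.lookup (f[xs]≤f[argmax] {f = size} P pre) p
    G : List Elt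
    G = common Fi
    G-unique : Unique G
    G-unique = Unique.filter⁺ (_∈? Fi) uniq
    G⊆F : G ⊆ F
    G⊆F = proj₁ ∘ ∈.∈-filter⁻ (_∈? Fi)
    maximal : ∀ H → ShellFace (P ∷ pre) F H → G ⊆ H → H ⊆ G
    maximal H (uH , H⊆F , any) G⊆H with find any
    ... | Fk , Fk∈ , H⊆Fk = ⊆-length⇒⊇ G-unique G⊆H
      (ℕ.≤-trans (length-⊆ uH (λ t∈ → ∈.∈-filter⁺ (_∈? Fk) (H⊆F t∈) (H⊆Fk t∈))) (size-max Fk∈))
    size-G : length G ≡ length F ∸ 1
    size-G = pure G (G-unique , G⊆F , lose Fi∈ (proj₂ ∘ ∈.∈-filter⁻ (_∈? Fi) {xs = F})) maximal
    other : ∀ u v → v ∈ F → v ∉ Fi → u ∈ F → u ≢ v → u ∈ Fi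
    other u v v∈ v∉ u∈ u≢v = decidable-stable (u ∈? Fi) λ u∉ → ℕ.1+n≰n {suc (length G)}
      (ℕ.≤-trans (length-⊆ (∉⇒Unique-∷ (new u∉) (∉⇒Unique-∷ (v∉ ∘ proj₂ ∘ ∈.∈-filter⁻ (_∈? Fi) {xs = F}) G-unique)) sub)
        (bound (length F) size-G))
      where
      new : u ∉ Fi → u ∉ v ∷ G
      new u∉ (here eq) = u≢v eq
      new u∉ (there p) = u∉ (proj₂ (∈.∈-filter⁻ (_∈? Fi) {xs = F} p))
      sub : u ∷ v ∷ G ⊆ F
      sub (here refl)         = u∈
      sub (there (here refl)) = v∈
      sub (there (there p))   = G⊆F p
      bound : ∀ k {l} → l ≡ k ∸ 1 → k ≤ℕ suc l
      bound zero    _    = z≤n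
      bound (suc k) refl = ℕ.≤-refl

  -- Some earlier facet contains all vertices of `F` but at most one, so by `sees-exchange` it sees
  -- whatever `F` sees. Repeating this leads back to `F₁`.
  shellable⇒sees : JoinSD _≤_ → Shellable → ∃[ F ] (Sat bot top F × Sees F)
  shellable⇒sees sd ([] , _ , _ , complete , _)
    with () ← complete _ (sat⇒maximal (proj₂ (sat-exists (bot-min top))))
  shellable⇒sees sd (F₁ ∷ rest , maxs , _ , complete , shell) =
    F₁ , maximal⇒sat (All.head maxs) , λ j s σ →
      -- A maximal chain through `s` sees `j` at `s`, and it occurs somewhere in the shelling.
      let c , S = sat-exists (bot-min s) ; d , S′ = sat-exists (top-max s) ; d′ , eq = sat-∷ S′
          F∈ = complete (c ++ d′) (sat⇒maximal (sat-++ S (subst (Sat s top) eq S′)))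
          pre , post , split = ∈.∈-∃++ F∈
      in go (length pre) pre ℕ.≤-refl split (∈.∈-++⁺ˡ (sat-last S)) σ
    where
    Fs : List (List Elt)
    Fs = F₁ ∷ rest
    sat : ∀ {F} → F ∈ Fs → Sat bot top F
    sat = maximal⇒sat ∘ All.lookup maxs
    go : ∀ k pre {F post} → length pre ≤ℕ k → Fs ≡ pre ++ F ∷ post → ∀ {v j} → v ∈ F → Seen j v →
         ∃[ x ] (x ∈ F₁ × Seen j x)
    go _ [] _ refl v∈ σ = _ , v∈ , σ
    go (suc k) (P ∷ pre) {F} {post} (s≤s len) split {v} {j} v∈ σ
      with large-intersection (sat-unique SF) (shell (P ∷ pre) F post split (λ ()))
      where
      F∈ : F ∈ Fs
      F∈ = subst (F ∈_) (sym split) (∈.∈-++⁺ʳ (P ∷ pre) (here refl))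
      SF : Sat bot top F
      SF = sat F∈
    ... | Fi , Fi∈ , others with ∈.∈-∃++ Fi∈
    ...   | ps , qs , eq = let x , x∈ , τ = seen in go k ps shorter split′ x∈ τ
      where
      split′ : Fs ≡ ps ++ Fi ∷ (qs ++ F ∷ post)
      split′ = trans split (trans (cong (_++ F ∷ post) eq) (List.++-assoc ps (Fi ∷ qs) (F ∷ post)))
      F∈ : F ∈ Fs
      F∈ = subst (F ∈_) (sym split) (∈.∈-++⁺ʳ (P ∷ pre) (here refl))
      Fi∈Fs : Fi ∈ Fs
      Fi∈Fs = subst (Fi ∈_) (sym split′) (∈.∈-++⁺ʳ ps (here refl))
      shorter : length ps ≤ℕ k
      shorter = ℕ.≤-pred (ℕ.≤-trans (ℕ.≤-trans (ℕ.m≤m+n (suc (length ps)) (length qs))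
        (ℕ.≤-reflexive (trans (sym (ℕ.+-suc (length ps) (length qs)))
          (trans (sym (List.length-++ ps)) (cong length (sym eq)))))) (s≤s len))
      seen : ∃[ x ] (x ∈ Fi × Seen j x)
      seen with v ∈? Fi
      ... | yes v∈Fi = v , v∈Fi , σ
      ... | no v∉Fi  = sees-exchange sd (sat F∈) (sat Fi∈Fs) v∈ σ (others v∈ v∉Fi)

  -- Enumerating the maximal chains

  _⋖?_ : ∀ x y → Dec (x ⋖ y)
  x ⋖? y = (x <? y) ×-dec
    map′ (λ none z x<z z<y → none (z , x<z , z<y)) (λ gap (z , x<z , z<y) → gap z x<z z<y)
      (¬? (Fin.any? λ z → (x <? z) ×-dec (z <? y)))

  private
    trivialSat : Elt → Elt → List (List Elt)
    trivialSat x y with x ≟ y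
    ... | yes _ = (x ∷ []) ∷ []
    ... | no _  = []

    sats : ∀ {x} → Acc (flip _<_) x → Elt → List (List Elt)
    through : ∀ {x} → (∀ {z} → x < z → Acc (flip _<_) z) → Elt → Elt → List (List Elt)
    sats {x} (acc rs) y = trivialSat x y ++ concatMap (through rs y) (allFin n)
    through {x} rs y z with x ⋖? z
    ... | yes p = map (x ∷_) (sats (rs (proj₁ p)) y)
    ... | no _  = []

    sats-complete : ∀ {x y c} (a : Acc (flip _<_) x) → Sat x y c → c ∈ sats a y
    sats-complete {x} (acc rs) [-] = ∈.∈-++⁺ˡ single
      where
      single : x ∷ [] ∈ trivialSat x x
      single with x ≟ x
      ... | yes _ = here refl
      ... | no ne = ⊥-elim (ne refl)
    sats-complete {x} {y} (acc rs) (_∷_ {y = z} {c = c} p S) =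
      ∈.∈-++⁺ʳ (trivialSat x y) (∈.∈-concatMap⁺ (through rs y) (lose (∈.∈-allFin z) extend))
      where
      extend : x ∷ c ∈ through rs y z
      extend with x ⋖? z
      ... | yes q = ∈.∈-map⁺ (x ∷_) (sats-complete (rs (proj₁ q)) S)
      ... | no nq = ⊥-elim (nq p)

    sats-sound : ∀ {x y c} (a : Acc (flip _<_) x) → c ∈ sats a y → Sat x y c
    sats-sound {x} {y} {c} (acc rs) c∈ with ∈.∈-++⁻ (trivialSat x y) c∈
    ... | inj₁ p = single p
      where
      single : c ∈ trivialSat x y → Sat x y c
      single p with x ≟ y | p
      ... | yes refl | here refl = [-]
    ... | inj₂ p with find (∈.∈-concatMap⁻ (through rs y) {xs = allFin n} p)
    ...   | z , _ , q = extend q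
      where
      extend : c ∈ through rs y z → Sat x y c
      extend q with x ⋖? z
      ... | yes x⋖z with ∈.∈-map⁻ (x ∷_) q
      ...   | d , d∈ , refl = x⋖z ∷ sats-sound (rs (proj₁ x⋖z)) d∈

  open import Data.List.Relation.Unary.Unique.DecPropositional.Properties (List.≡-dec _≟_)
    using (deduplicate-!)

  facets : List (List Elt)
  facets = deduplicate (List.≡-dec _≟_) (sats (>-wellFounded bot) top)

  facets-unique : Unique facets
  facets-unique = deduplicate-! _

  facets-complete : ∀ {F} → Sat bot top F → F ∈ facets
  facets-complete S = ∈.∈-deduplicate⁺ (List.≡-dec _≟_) (sats-complete (>-wellFounded bot) S)

  facets-sound : ∀ {F} → F ∈ facets → Sat bot top F
  facets-sound F∈ = sats-sound (>-wellFounded bot) (∈.∈-deduplicate⁻ (List.≡-dec _≟_) _ F∈)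

  -- Label words and EL-labellings

  module Labelled (P : Poset 0ℓ 0ℓ 0ℓ) (lab : Elt → Elt → Poset.Carrier P) where
    private
      module P = Poset P
      _≺_ : Rel P.Carrier 0ℓ
      _≺_ = _<ₚ_ P

    word : List Elt → List P.Carrier
    word = labelWord P lab

    _<lex_ : Rel (List P.Carrier) 0ℓ
    _<lex_ = Lex-< P._≈_ _≺_

    linked⇒place : ∀ {c u v w} → Linked _≺_ (word c) → Place u v w c → lab u v ≺ lab v w
    linked⇒place (r ∷ _) here = r
    linked⇒place {_ ∷ _ ∷ _ ∷ _} (_ ∷ l) (there p) = linked⇒place l p
    linked⇒place {_ ∷ _ ∷ []} _ (there (there ()))
    linked⇒place {_ ∷ []} _ (there ())

    places⇒linked : ∀ c → (∀ {u v w} → Place u v w c → lab u v ≺ lab v w) → Linked _≺_ (word c)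
    places⇒linked []              _ = []
    places⇒linked (_ ∷ [])        _ = []
    places⇒linked (_ ∷ _ ∷ [])    _ = [-]
    places⇒linked (_ ∷ v ∷ w ∷ c) q = q here ∷ places⇒linked (v ∷ w ∷ c) (q ∘ there)

    private
      -- `c` has at least two steps, as `v` lies strictly between its ends. The comparison with a
      -- two-letter word is therefore settled by one of the first two letters, and the common
      -- continuation `r` does not affect it.
      prefix-lex : ∀ {u v w c} r → u ⋖ v → v ⋖ w → Sat u w c → word c <lex word (u ∷ v ∷ w ∷ []) →
                   word (c ++ r) <lex word (u ∷ v ∷ w ∷ r)
      prefix-lex r p q [-] _ = ⊥-elim (<⇒≱ (<-trans (proj₁ p) (proj₁ q)) O.refl)
      prefix-lex r p q (g ∷ [-]) _ = ⊥-elim (proj₂ g _ (proj₁ p) (proj₁ q))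
      prefix-lex r p q (_ ∷ _ ∷ S) lt with sat-∷ S
      prefix-lex r p q (_ ∷ _ ∷ S) (this lt)           | _ , refl = this lt
      prefix-lex r p q (_ ∷ _ ∷ S) (next e (this lt))  | _ , refl = next e (this lt)
      prefix-lex r p q (_ ∷ _ ∷ S) (next e (next _ l)) | _ , refl = ⊥-elim (xs≮[] l)

    replace : ∀ {x y F u v w c} → Sat x y F → Place u v w F → Sat u w c →
      word c <lex word (u ∷ v ∷ w ∷ []) →
      ∃[ F′ ] (Sat x y F′ × (∀ {t} → t ∈ F → t ≢ v → t ∈ F′) × word F′ <lex word F)
    replace {c = c} (p ∷ q ∷ S) here C lt with sat-∷ S
    ... | r , refl = c ++ r , sat-++ C S ,
      (λ { (here refl) _ → ∈.∈-++⁺ˡ (sat-first C)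
         ; (there (here refl)) ne → ⊥-elim (ne refl)
         ; (there (there (here refl))) _ → ∈.∈-++⁺ˡ (sat-last C)
         ; (there (there (there t∈))) _ → ∈.∈-++⁺ʳ c t∈ }) ,
      prefix-lex r p q C lt
    replace (p ∷ S) (there pl) C lt with replace S pl C lt
    ... | F′ , S′ , sub , lt′ with sat-∷ S | sat-∷ S′
    ...   | _ , refl | _ , refl = _ , p ∷ S′ ,
      (λ { (here refl) _ → here refl ; (there t∈) ne → there (sub t∈ ne) }) , next P.Eq.refl lt′

    module EL (el : IsELLabelling P lab) where

      private
        -- The increasing chain of `[u , w]` precedes `u ∷ v ∷ w ∷ []` lexicographically and is
        -- spliced into `F` in its place.
        replace-by-increasing : ∀ {x y F u v w} → Sat x y F → Place u v w F → (u≤w : u ≤ w) →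
          proj₁ (el u w u≤w) ≢ u ∷ v ∷ w ∷ [] →
          ∃[ F′ ] (Sat x y F′ × (∀ {t} → t ∈ F → t ≢ v → t ∈ F′) × word F′ <lex word F)
        replace-by-increasing {u = u} {w = w} S pl u≤w ne =
          let p , q = sat-place S pl ; c , max , _ , _ , least = el u w u≤w
          in replace S pl (maximalIn⇒sat u≤w max) (least _ (sat⇒maximalIn (p ∷ q ∷ [-])) (ne ∘ sym))

      replace-nonincreasing : ∀ {x y F u v w} → Sat x y F → Place u v w F → ¬ (lab u v ≺ lab v w) →
        ∃[ F′ ] (Sat x y F′ × (∀ {t} → t ∈ F → t ≢ v → t ∈ F′) × word F′ <lex word F)
      replace-nonincreasing {u = u} {v} {w} S pl ¬inc = replace-by-increasing S pl u≤w λ eq →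
        ¬inc (Linked.head (subst (Linked _≺_ ∘ word) eq (proj₁ (proj₂ (proj₂ (el u w u≤w))))))
        where
        u≤w : u ≤ w
        u≤w = let p , q = sat-place S pl in O.trans (proj₁ (proj₁ p)) (proj₁ (proj₁ q))

      private
        -- The order on labels need not be decidable, so the test compares vertices instead: is the
        -- increasing chain of `[u , w]` the given one?
        increasing? : ∀ u v w → (u ≤ w → lab u v ≺ lab v w) ⊎
          Σ (u ≤ w) (λ u≤w → proj₁ (el u w u≤w) ≢ u ∷ v ∷ w ∷ [])
        increasing? u v w with u ≤? w
        ... | no ¬p = inj₁ (⊥-elim ∘ ¬p)
        ... | yes p with List.≡-dec _≟_ (proj₁ (el u w p)) (u ∷ v ∷ w ∷ [])
        ...   | no ne  = inj₂ (p , ne)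
        ...   | yes eq = inj₁ λ _ → Linked.head (subst (Linked _≺_ ∘ word) eq (proj₁ (proj₂ (proj₂ (el u w p)))))

        F₀ : List Elt
        F₀ = proj₁ (el bot top (bot-min top))

      -- A facet increasing at every place is `F₀` by uniqueness; any other has a place where the
      -- increasing chain is a different one.
      improve : ∀ {F} → Sat bot top F → F ≢ F₀ →
        ∃[ v ] ∃[ F′ ] (Sat bot top F′ × (∀ {t} → t ∈ F → t ≢ v → t ∈ F′) × word F′ <lex word F)
      improve {F} S F≢F₀ with places? increasing? F
      ... | inj₁ inc = ⊥-elim (F≢F₀ (proj₁ (proj₂ (proj₂ (proj₂ (el bot top (bot-min top))))) F (sat⇒maximalIn S)
              (places⇒linked F λ pl → inc pl (let p , q = sat-place S pl in O.trans (proj₁ (proj₁ p)) (proj₁ (proj₁ q))))))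
      ... | inj₂ (u , v , w , pl , u≤w , ne) = v , replace-by-increasing S pl u≤w ne

      private
        -- Facets are compared through their indices, because strict partial orders on a `Fin` are
        -- well founded.
        _⊏_ : Rel (Fin (length facets)) 0ℓ
        i ⊏ k = word (lookup facets i) <lex word (lookup facets k)

        module Lex-SPO = IsStrictPartialOrder (Lex.<-isStrictPartialOrder P.isPartialOrder)

        ⊏-wellFounded : WellFounded _⊏_
        ⊏-wellFounded = spo-wellFounded {_≈_ = _≡_} (record
          { isEquivalence = isEquivalence ; irrefl = λ { refl → Lex-SPO.irrefl Lex-SPO.Eq.refl }
          ; trans = Lex-SPO.trans ; <-resp-≈ = resp₂ _⊏_ })

      -- Descending through lexicographically smaller facets, a facet that sees
      -- j is carried to the increasing one.
      sees : JoinSD _≤_ → Sees F₀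
      sees sd j s σ =
        let c , S = sat-exists (bot-min s) ; d , S′ = sat-exists (top-max s) ; d′ , eq = sat-∷ S′
            F∈ = facets-complete (sat-++ S (subst (Sat s top) eq S′))
        in go (⊏-wellFounded (Any.index F∈)) (subst (s ∈_) (Any.lookup-index F∈) (∈.∈-++⁺ˡ (sat-last S))) σ
        where
        go : ∀ {i v} → Acc _⊏_ i → v ∈ lookup facets i → Seen j v → ∃[ x ] (x ∈ F₀ × Seen j x)
        go {i} {v} (acc rs) v∈ σ with List.≡-dec _≟_ (lookup facets i) F₀
        ... | yes eq = v , subst (v ∈_) eq v∈ , σ
        ... | no ne with improve (facets-sound (∈.∈-lookup i)) ne
        ...   | v′ , F′ , S′ , sub , lt with facets-complete S′
        ...     | F′∈ with Any.index F′∈ | Any.lookup-index F′∈ | v ≟ v′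
        ...       | k | refl | no v≢v′ = go (rs lt) (sub v∈ v≢v′) σ
        ...       | k | refl | yes refl =
          let x , x∈ , τ = sees-exchange sd (facets-sound (∈.∈-lookup i)) S′ v∈ σ sub in go (rs lt) x∈ τ

      increasing-facet-sees : JoinSD _≤_ → ∃[ F ] (Sat bot top F × Sees F)
      increasing-facet-sees sd =
        F₀ , maximalIn⇒sat (bot-min top) (proj₁ (proj₂ (el bot top (bot-min top)))) , sees sd

-- Least witnesses by bounded search

-- The bound `m` is returned untested when there is no smaller witness, so `search-sat` asks for
-- `P m`.
search : {P : ℕ → Set} → (∀ k → Dec (P k)) → ℕ → ℕ
search P? zero    = zero
search P? (suc m) with P? 0
... | yes _ = zero
... | no _  = suc (search (P? ∘ suc) m)

search-sat : ∀ {P : ℕ → Set} (P? : ∀ k → Dec (P k)) m → P m → P (search P? m)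
search-sat P? zero    p = p
search-sat P? (suc m) p with P? 0
... | yes p₀ = p₀
... | no _   = search-sat (P? ∘ suc) m p

search-min : ∀ {P : ℕ → Set} (P? : ∀ k → Dec (P k)) m {k} → k <ℕ search P? m → ¬ P k
search-min P? (suc m) {k} lt with P? 0
search-min P? (suc m) {zero}  lt       | no ¬p = ¬p
search-min P? (suc m) {suc k} (s≤s lt) | no ¬p = search-min (P? ∘ suc) m lt

-- Labelling by a left modular chain

-- The label of p ⋖ q is the least k with q ≤ p ∨ f k, where f runs through a
-- maximal chain of left modular elements; for arbitrary p < q the same formula
-- yields the first label of the increasing chain of [p , q].
module LeftModularLabelling (K : FinLattice) (e : FinLattice.Elt K) where
  open FinLattice K
  open Chains K
  open Bounded K e
  open Shellings K e

  module Labelling (f : ℕ → Elt) (N : ℕ) (f-zero : f 0 ≡ bot) (f-last : f N ≡ top)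
    (f-lm : ∀ k → LeftModularElement (f k)) (f-≤ : ∀ k → f k ≤ f (suc k))
    (f-step : ∀ k {z} → f k ≤ z → z ≤ f (suc k) → z ≡ f k ⊎ z ≡ f (suc k)) where

    abstract
      -- For `p < q`, left modularity turns `p ∨ (f k ∧ q)` into `(p ∨ f k) ∧ q`, so on a cover the
      -- tested condition says `q ≤ p ∨ f k`.
      lab : Elt → Elt → ℕ
      lab p q = search (λ k → ¬? ((f k ∧ q) ≤? p)) N

      lab-≰ : ∀ {p q} → ¬ q ≤ p → ¬ (f (lab p q) ∧ q) ≤ p
      lab-≰ {p} {q} q≰p = search-sat (λ k → ¬? ((f k ∧ q) ≤? p)) N λ le →
        q≰p (O.trans (∧-greatest (subst (q ≤_) (sym f-last) (top-max q)) O.refl) le)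

      lab-≤ : ∀ {p q k} → k <ℕ lab p q → (f k ∧ q) ≤ p
      lab-≤ {p} {q} {k} lt =
        decidable-stable ((f k ∧ q) ≤? p) (search-min (λ k → ¬? ((f k ∧ q) ≤? p)) N lt)

    lab-least : ∀ {p q k} → ¬ (f k ∧ q) ≤ p → lab p q ≤ℕ k
    lab-least np = ℕ.≮⇒≥ (np ∘ lab-≤)

    ∧-monoʳ : ∀ x {y z} → y ≤ z → (x ∧ y) ≤ (x ∧ z)
    ∧-monoʳ x y≤z = ∧-greatest (x∧y≤x _ _) (O.trans (x∧y≤y _ _) y≤z)

    lab-antimono : ∀ {p v g} → v ≤ g → ¬ v ≤ p → lab p g ≤ℕ lab p v
    lab-antimono v≤g v≰p = lab-least λ le → lab-≰ v≰p (O.trans (∧-monoʳ _ v≤g) le)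

    -- The vertex after `p` on the increasing chain of `[p , q]`.
    atom : Elt → Elt → Elt
    atom p q = p ∨ (f (lab p q) ∧ q)

    atom-≤ : ∀ {p q} → p ≤ q → atom p q ≤ q
    atom-≤ p≤q = ∨-least p≤q (x∧y≤y _ _)

    -- Let `w` be strictly between `p` and `z = atom p q`, and let `x` and `y` be the chain elements
    -- before and at the label, so that `x ∧ q ≤ p`. Left modularity of `y` on `p < w` shows
    -- `y ∧ w ≰ x`, hence `y ≤ w ∨ x`. Left modularity of `x` on `w < z` then gives
    -- `z ≤ w ∨ (x ∧ z) ≤ w`.
    p⋖atom : ∀ {p q} → p < q → p ⋖ atom p q
    p⋖atom {p} {q} p<q = (x≤x∨y _ _ , λ eq → lab-≰ q≰p (subst ((f (lab p q) ∧ q) ≤_) (sym eq) (y≤x∨y _ _))) ,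
      λ w p<w w<z → gap w p<w w<z (lab p q) refl
      where
      q≰p : ¬ q ≤ p
      q≰p = <⇒≱ p<q
      gap : ∀ w → p < w → w < atom p q → ∀ k → k ≡ lab p q → ⊥
      gap w p<w w<z zero eq = lab-≰ q≰p
        (subst (λ k → (f k ∧ q) ≤ p) eq (O.trans (x∧y≤x _ _) (O.trans (O.reflexive f-zero) (bot-min p))))
      gap w p<w w<z (suc k) eq = <⇒≱ w<z z≤w
        where
        z x y : Elt
        z = atom p q
        x = f k
        y = f (suc k)
        z≡ : z ≡ (p ∨ (y ∧ q))
        z≡ = cong (λ k → p ∨ (f k ∧ q)) (sym eq)
        w≤z : w ≤ z
        w≤z = proj₁ w<z
        z≤q : z ≤ q
        z≤q = atom-≤ (proj₁ p<q)
        x∧q≤p : (x ∧ q) ≤ p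
        x∧q≤p = lab-≤ (subst (suc k ≤ℕ_) eq ℕ.≤-refl)
        z≤p∨y : z ≤ (p ∨ y)
        z≤p∨y = O.trans (O.reflexive z≡) (∨-least (x≤x∨y _ _) (O.trans (x∧y≤x _ _) (y≤x∨y _ _)))
        w≤ : w ≤ (p ∨ (y ∧ w))
        w≤ = subst (w ≤_) (f-lm (suc k) p w p<w) (∧-greatest (O.trans w≤z z≤p∨y) O.refl)
        y∧w≰x : ¬ (y ∧ w) ≤ x
        y∧w≰x le = <⇒≱ p<w (O.trans w≤ (∨-least O.refl
          (O.trans (∧-greatest le (O.trans (x∧y≤y _ _) (O.trans w≤z z≤q))) x∧q≤p)))
        y≤w∨x : y ≤ (w ∨ x)
        y≤w∨x with f-step k (x≤x∨y x (y ∧ w)) (∨-least (f-≤ k) (x∧y≤x _ _))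
        ... | inj₁ eq′ = ⊥-elim (y∧w≰x (subst (_ ≤_) eq′ (y≤x∨y _ _)))
        ... | inj₂ eq′ = O.trans (O.reflexive (sym eq′))
                           (∨-least (y≤x∨y _ _) (O.trans (x∧y≤y _ _) (x≤x∨y _ _)))
        z≤w : z ≤ w
        z≤w = O.trans (subst (z ≤_) (f-lm k w z w<z) (∧-greatest
                (O.trans z≤p∨y (∨-least (O.trans (proj₁ p<w) (x≤x∨y _ _)) y≤w∨x)) O.refl))
              (∨-least O.refl (O.trans (∧-monoʳ x z≤q) (O.trans x∧q≤p (proj₁ p<w))))

    lab-atom : ∀ {p q} → p < q → lab p (atom p q) ≡ lab p q
    lab-atom {p} {q} p<q = ℕ.≤-antisym
      (lab-least λ le → lab-≰ (<⇒≱ p<q) (O.trans (∧-greatest (x∧y≤x _ _) (y≤x∨y _ _)) le))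
      (lab-antimono (atom-≤ (proj₁ p<q)) (<⇒≱ (proj₁ (p⋖atom p<q))))

    -- For every `k` up to `lab p q`, the element `f k ∧ q` is already below `atom p q`.
    lab-increases : ∀ {p q} → ¬ q ≤ atom p q → lab p q <ℕ lab (atom p q) q
    lab-increases {p} {q} q≰z = ℕ.≰⇒> λ le → lab-≰ q≰z (below (ℕ.m≤n⇒m<n∨m≡n le))
      where
      below : ∀ {k} → k <ℕ lab p q ⊎ k ≡ lab p q → (f k ∧ q) ≤ atom p q
      below (inj₁ lt)   = O.trans (lab-≤ lt) (x≤x∨y _ _)
      below (inj₂ refl) = y≤x∨y _ _

    -- Both sides cover `p`. With `k` the common label, `v = p ∨ (f k ∧ v) ≤ p ∨ (f k ∧ g)`, which
    -- is the atom.
    first-label⇒atom : ∀ {p v g} → p ⋖ v → v ≤ g → lab p v ≡ lab p g → v ≡ atom p g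
    first-label⇒atom {p} {v} {g} p⋖v v≤g eq =
      [ (λ v≡p → ⊥-elim (proj₂ (proj₁ p⋖v) (sym v≡p))) , id ]
        (⋖-≤ (p⋖atom (<-≤-trans (proj₁ p⋖v) v≤g)) (proj₁ (proj₁ p⋖v)) v≤atom)
      where
      v≤atom : v ≤ atom p g
      v≤atom with ⋖-≤ p⋖v (x≤x∨y p (f (lab p v) ∧ v)) (∨-least (proj₁ (proj₁ p⋖v)) (x∧y≤y _ _))
      ... | inj₁ eq′ = ⊥-elim (lab-≰ (<⇒≱ (proj₁ p⋖v)) (subst ((f (lab p v) ∧ v) ≤_) eq′ (y≤x∨y _ _)))
      ... | inj₂ eq′ = O.trans (O.reflexive (sym eq′)) (∨-least (x≤x∨y _ _)
        (O.trans (∧-monoʳ _ v≤g) (subst (λ k → (f k ∧ g) ≤ atom p g) (sym eq) (y≤x∨y _ _))))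

    -- The chain iterates `atom _ q`. The clause on the first label is what the induction needs to
    -- compare the first two labels.
    increasing-chain : ∀ {p q} → p ≤ q → ∃[ c ] (Sat p q c ×
      (∀ {u v w} → Place u v w c → lab u v <ℕ lab v w) × (∀ {v d} → c ≡ p ∷ v ∷ d → lab p v ≡ lab p q))
    increasing-chain {p} = go (>-wellFounded p)
      where
      go : ∀ {p q} → Acc (flip _<_) p → p ≤ q → ∃[ c ] (Sat p q c ×
        (∀ {u v w} → Place u v w c → lab u v <ℕ lab v w) × (∀ {v d} → c ≡ p ∷ v ∷ d → lab p v ≡ lab p q))
      go {p} {q} (acc rs) p≤q with p ≟ q
      ... | yes refl = _ , [-] , (λ { (there ()) }) , λ ()
      ... | no ne with p⋖atom (p≤q , ne)
      ...   | p⋖z with go (rs (proj₁ p⋖z)) (atom-≤ p≤q)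
      ...     | c , S , inc , first = p ∷ c , p⋖z ∷ S , inc′ S first inc , first′ S
        where
        first′ : ∀ {c} → Sat (atom p q) q c → ∀ {v d} → p ∷ c ≡ p ∷ v ∷ d → lab p v ≡ lab p q
        first′ S eq with sat-∷ S
        first′ S refl | _ , refl = lab-atom (p≤q , ne)
        inc′ : ∀ {c} → Sat (atom p q) q c → (∀ {v d} → c ≡ atom p q ∷ v ∷ d → lab (atom p q) v ≡ lab (atom p q) q) →
          (∀ {u v w} → Place u v w c → lab u v <ℕ lab v w) →
          ∀ {u v w} → Place u v w (p ∷ c) → lab u v <ℕ lab v w
        inc′ S first inc (there pl) = inc pl
        inc′ (z⋖w ∷ S) first inc here with sat-∷ S
        ... | _ , refl = subst (lab p (atom p q) <ℕ_) (sym (first refl))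
          (subst (_<ℕ lab (atom p q) q) (sym (lab-atom (p≤q , ne))) (lab-increases (<⇒≱ (<-≤-trans (proj₁ z⋖w) (sat-≤ S)))))

    -- Lexicographic comparison and the shelling

    -- The exceptional set `G` is empty for the EL-property and a face of the intersection for the
    -- shelling.
    IncreasingOff : List Elt → List Elt → Set
    IncreasingOff G c = ∀ {u v w} → Place u v w c → v ∈ G ⊎ lab u v <ℕ lab v w

    private
      -- `g` is the first vertex after `p` that lies in `G`, or else the end `q`. If `k = lab p g`
      -- were smaller than `lab p v`, it would be smaller than `lab v g` too, by induction and the
      -- increase at `v`. Then `f k ∧ g ≤ v`, so `f k ∧ g ≤ p`, against the choice of `k`.
      first-segment : ∀ {G p v q c} → p ⋖ v → Sat v q c → IncreasingOff G (p ∷ c) →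
        ∃[ g ] (g ∈ c × v ≤ g × (g ∈ G ⊎ g ≡ q) × lab p v ≡ lab p g)
      first-segment {G} {v = v} p⋖v S inc with v ∈? G
      ... | yes v∈ = v , sat-first S , O.refl , inj₁ v∈ , refl
      first-segment {v = v} p⋖v [-] inc | no _ = v , here refl , O.refl , inj₂ refl , refl
      first-segment {p = p} {v} p⋖v (v⋖w ∷ S) inc | no v∉ with sat-∷ S
      ... | _ , refl with first-segment v⋖w S (inc ∘ there) | inc here
      ...   | _ | inj₁ v∈ = ⊥-elim (v∉ v∈)
      ...   | g , g∈ , w≤g , end , eq | inj₂ lt =
        g , there g∈ , v≤g , end , ℕ.≤-antisym (ℕ.≮⇒≥ not-smaller) (lab-antimono v≤g (<⇒≱ (proj₁ p⋖v)))
        where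
        v≤g : v ≤ g
        v≤g = O.trans (proj₁ (proj₁ v⋖w)) w≤g
        not-smaller : ¬ lab p g <ℕ lab p v
        not-smaller lt′ = lab-≰ (<⇒≱ (<-≤-trans (proj₁ p⋖v) v≤g)) (O.trans
          (∧-greatest (x∧y≤x _ _) (lab-≤ (ℕ.<-trans lt′ (subst (lab p v <ℕ_) eq lt))))
          (lab-≤ lt′))

    open Labelled ℕ.≤-poset lab

    -- If g is the next vertex of G on c, then c starts with the first step of the
    -- increasing chain of [p , g]; as c′ also passes through g, its first label
    -- is at least as large, with equality only for the same step.
    increasingOff⇒lex-least : ∀ G {p q c c′} → Sat p q c → Sat p q c′ → (∀ {g} → g ∈ G → g ∈ c → g ∈ c′) →
      IncreasingOff G c → c ≡ c′ ⊎ word c <lex word c′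
    increasingOff⇒lex-least G [-] [-] _ _ = inj₁ refl
    increasingOff⇒lex-least G [-] (p ∷ S) _ _ = ⊥-elim (<⇒≱ (<-≤-trans (proj₁ p) (sat-≤ S)) O.refl)
    increasingOff⇒lex-least G (p ∷ S) [-] _ _ = ⊥-elim (<⇒≱ (<-≤-trans (proj₁ p) (sat-≤ S)) O.refl)
    increasingOff⇒lex-least G {p} {q} (_∷_ {y = v} {c = c} p⋖v S) (_∷_ {y = v′} {c = c′} p⋖v′ S′) sub inc
      with first-segment p⋖v S inc
    ... | g , g∈ , v≤g , end , eq = compare (ℕ.m≤n⇒m<n∨m≡n (subst (_≤ℕ lab p v′) (sym eq)
                                      (lab-antimono v′≤g (<⇒≱ (proj₁ p⋖v′)))))
      where
      tail : ∀ {t} → p < t → t ∈ p ∷ c′ → t ∈ c′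
      tail p<t (here refl) = ⊥-elim (proj₂ p<t refl)
      tail p<t (there t∈)  = t∈
      v′≤g : v′ ≤ g
      v′≤g = sat-lower S′ ([ (λ g∈G → tail (<-≤-trans (proj₁ p⋖v) v≤g) (sub g∈G (there g∈))) ,
                             (λ { refl → sat-last S′ }) ] end)
      same : v ≡ v′ → p ∷ c ≡ p ∷ c′ ⊎ word (p ∷ c) <lex word (p ∷ c′)
      same refl with increasingOff⇒lex-least G S S′
        (λ g∈G g∈c → tail (<-≤-trans (proj₁ p⋖v) (sat-lower S g∈c)) (sub g∈G (there g∈c))) (inc ∘ there)
      ... | inj₁ c≡c′ = inj₁ (cong (p ∷_) c≡c′)
      ... | inj₂ lt with sat-∷ S | sat-∷ S′
      ...   | _ , refl | _ , refl = inj₂ (next refl lt)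
      compare : lab p v <ℕ lab p v′ ⊎ lab p v ≡ lab p v′ → p ∷ c ≡ p ∷ c′ ⊎ word (p ∷ c) <lex word (p ∷ c′)
      compare (inj₂ eq′) = same (trans (first-label⇒atom p⋖v v≤g eq)
                                  (sym (first-label⇒atom p⋖v′ v′≤g (trans (sym eq′) eq))))
      compare (inj₁ lt) with sat-∷ S | sat-∷ S′
      ... | _ , refl | _ , refl = inj₂ (this (ℕ.<⇒≤ lt , ℕ.<⇒≢ lt))

    private
      lex-asym : ∀ {xs ys} → xs <lex ys → ¬ Lex.Lex-≤ _≡_ _≤ℕ_ ys xs
      lex-asym (this (p , ne)) (this (q , _)) = ne (ℕ.≤-antisym p q)
      lex-asym (this (_ , ne)) (next eq _)    = ne (sym eq)
      lex-asym (next eq _)     (this (_ , ne)) = ne (sym eq)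
      lex-asym (next _ l)      (next _ l′)    = lex-asym l l′

      <lex⇒≤lex : ∀ {xs ys} → xs <lex ys → Lex.Lex-≤ _≡_ _≤ℕ_ xs ys
      <lex⇒≤lex halt       = halt
      <lex⇒≤lex (this lt)  = this lt
      <lex⇒≤lex (next e l) = next e (<lex⇒≤lex l)

    isELLabelling : IsELLabelling ℕ.≤-poset lab
    isELLabelling x y x≤y with increasing-chain x≤y
    ... | c , S , inc , _ = c , sat⇒maximalIn S , places⇒linked c (λ pl → ℕ.<⇒≤ (inc pl) , ℕ.<⇒≢ (inc pl)) ,
      (λ c′ M l → uniq c′ (maximalIn⇒sat x≤y M) l) ,
      λ c′ M ne → [ (λ eq → ⊥-elim (ne (sym eq))) , id ] (least (maximalIn⇒sat x≤y M) S inc)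
      where
      least : ∀ {c c′} → Sat x y c′ → Sat x y c → (∀ {u v w} → Place u v w c → lab u v <ℕ lab v w) →
              c ≡ c′ ⊎ word c <lex word c′
      least S′ S inc = increasingOff⇒lex-least [] S S′ (λ ()) (inj₂ ∘ inc)
      uniq : ∀ c′ → Sat x y c′ → Linked (_<ₚ_ ℕ.≤-poset) (word c′) → c′ ≡ c
      uniq c′ S′ l with least S S′ (λ pl → let p , ne = linked⇒place l pl in ℕ.≤∧≢⇒< p ne) | least S′ S inc
      ... | inj₁ eq | _       = eq
      ... | inj₂ _  | inj₁ eq = sym eq
      ... | inj₂ lt | inj₂ gt = ⊥-elim (lex-asym lt (<lex⇒≤lex gt))

    elShellable : ELShellable
    elShellable = ℕ.≤-poset , lab , isELLabelling

    private
      -- Facets with the same word count as equal in this order; the absence of repetitions is kept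
      -- separately in `Fs-unique`.
      wordOrder : DecTotalOrder 0ℓ 0ℓ 0ℓ
      wordOrder = On.decTotalOrder (Lex.≤-decTotalOrder ℕ.≤-decTotalOrder) word

      module W = DecTotalOrder wordOrder
      open import Data.List.Sort wordOrder using (sort; sort-↭; sort-↗)

      Fs : List (List Elt)
      Fs = sort facets

      Fs-sound : ∀ {F} → F ∈ Fs → Sat bot top F
      Fs-sound = facets-sound ∘ ∈-resp-↭ (sort-↭ facets)

      Fs-complete : ∀ {F} → Sat bot top F → F ∈ Fs
      Fs-complete = ∈-resp-↭ (↭-sym (sort-↭ facets)) ∘ facets-complete

      Fs-unique : Unique Fs
      Fs-unique = Unique-resp-↭ (setoid _) (↭⇒↭ₛ (↭-sym (sort-↭ facets))) facets-unique

      split : ∀ {R : Rel (List Elt) 0ℓ} pre {F post} → AllPairs R (pre ++ F ∷ post) →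
              (∀ {H} → H ∈ pre → R H F) × (∀ {H} → H ∈ post → R F H)
      split []        (a ∷ _)  = (λ ()) , All.lookup a
      split (P ∷ pre) (a ∷ ps) = let before , after = split pre ps in
        (λ { (here refl) → All.lookup a (∈.∈-++⁺ʳ pre (here refl)) ; (there H∈) → before H∈ }) , after

      Fs-before : ∀ {pre F post} → Fs ≡ pre ++ F ∷ post → ∀ {H} → H ∈ pre → H ≢ F × H W.≤ F
      Fs-before {pre} eq H∈ = proj₁ (split pre (subst Unique eq Fs-unique)) H∈ ,
        proj₁ (split pre (subst (AllPairs W._≤_) eq (Linked.Linked⇒AllPairs W.trans (sort-↗ facets)))) H∈

      Fs-lex-smaller : ∀ {pre F post} → Fs ≡ pre ++ F ∷ post →
                       ∀ {H} → H ∈ Fs → word H <lex word F → H ∈ pre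
      Fs-lex-smaller {pre} eq {H} H∈ lt with ∈.∈-++⁻ pre (subst (H ∈_) eq H∈)
      ... | inj₁ p           = p
      ... | inj₂ (here refl) = ⊥-elim (lex-asym lt (<lex⇒≤lex lt))
      ... | inj₂ (there q)   = ⊥-elim (lex-asym lt
        (proj₂ (split pre (subst (AllPairs W._≤_) eq (Linked.Linked⇒AllPairs W.trans (sort-↗ facets)))) q))

    -- If `F` increased at every vertex outside `G`, it would precede every other maximal chain
    -- containing `G`, against `F′ W.≤ F`. So the labels fail to increase at some `v ∉ G`, and the
    -- EL-property replaces `v`.
    lex-smaller-neighbour : ∀ {F F′ G} → Sat bot top F → Sat bot top F′ → F′ ≢ F → F′ W.≤ F → G ⊆ F′ →
      ∃[ v ] (v ∈ F × v ∉ G × ∃[ H ] (Sat bot top H × (∀ {t} → t ∈ F → t ≢ v → t ∈ H) × word H <lex word F))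
    lex-smaller-neighbour {F} {F′} {G} S S′ F′≢F F′≤F G⊆F′ = go (places? increasing? F)
      where
      increasing? : ∀ u v w → (v ∈ G ⊎ lab u v <ℕ lab v w) ⊎ (v ∉ G × ¬ lab u v <ℕ lab v w)
      increasing? u v w with v ∈? G | lab u v ℕ.<? lab v w
      ... | yes v∈ | _      = inj₁ (inj₁ v∈)
      ... | no _   | yes lt = inj₁ (inj₂ lt)
      ... | no v∉  | no nlt = inj₂ (v∉ , nlt)
      go : IncreasingOff G F ⊎ ∃[ u ] ∃[ v ] ∃[ w ] (Place u v w F × v ∉ G × ¬ lab u v <ℕ lab v w) → _
      go (inj₁ inc) = ⊥-elim ([ F′≢F ∘ sym , (λ lt → lex-asym lt F′≤F) ]
        (increasingOff⇒lex-least G S S′ (λ g∈ _ → G⊆F′ g∈) inc))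
      go (inj₂ (u , v , w , pl , v∉G , nlt)) =
        v , proj₁ (proj₂ (place-∈ pl)) , v∉G ,
        EL.replace-nonincreasing isELLabelling S pl (λ (p , ne) → nlt (ℕ.≤∧≢⇒< p ne))

    isShelling : IsShelling Fs
    isShelling = All.tabulate (sat⇒maximal ∘ Fs-sound) , Fs-unique , (λ F → Fs-complete ∘ maximal⇒sat) ,
      λ pre F post eq _ G face maximal → pure eq G face maximal
      where
      -- A facet `G` of the intersection lies in an earlier `Fi`. The neighbour `H` of `F` is
      -- lexicographically smaller, hence also earlier, and it keeps every vertex of `F` other than
      -- some `v ∉ G`; so `facet-size` applies.
      pure : ∀ {pre F post} → Fs ≡ pre ++ (F ∷ post) → PureOfDim (ShellFace pre F) (length F ∸ 1)
      pure {pre} {F} eq G face@(_ , _ , any) maximal =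
        let Fi , Fi∈ , G⊆Fi = find any
            Fi≢F , Fi≤F = Fs-before eq Fi∈
            SF = Fs-sound (subst (F ∈_) (sym eq) (∈.∈-++⁺ʳ pre (here refl)))
            SFi = Fs-sound (subst (Fi ∈_) (sym eq) (∈.∈-++⁺ˡ Fi∈))
            v , v∈F , v∉G , H , SH , sub , lt = lex-smaller-neighbour SF SFi Fi≢F Fi≤F G⊆Fi
        in facet-size (sat-unique SF) face maximal v∈F v∉G (Fs-lex-smaller eq (Fs-complete SH) lt) sub

    shellable : Shellable
    shellable = Fs , isShelling

  -- Indices past the end return the last vertex, which is why `nth-cover` allows equality.
  nth : Elt → List Elt → ℕ → Elt
  nth x []      _       = x
  nth x (_ ∷ _) zero    = x
  nth x (y ∷ c) (suc k) = nth y c k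

  nth-zero : ∀ x c → nth x c 0 ≡ x
  nth-zero x []      = refl
  nth-zero x (_ ∷ _) = refl

  nth-∈ : ∀ x c k → nth x c k ∈ x ∷ c
  nth-∈ x []      _       = here refl
  nth-∈ x (_ ∷ _) zero    = here refl
  nth-∈ x (y ∷ c) (suc k) = there (nth-∈ y c k)

  nth-last : ∀ {x y c} → Sat x y (x ∷ c) → nth x c (length c) ≡ y
  nth-last [-]     = refl
  nth-last (_ ∷ S) with sat-∷ S
  ... | _ , refl = nth-last S

  nth-cover : ∀ {x y c} → Sat x y (x ∷ c) → ∀ k → nth x c k ⋖ nth x c (suc k) ⊎ nth x c k ≡ nth x c (suc k)
  nth-cover [-] _ = inj₂ refl
  nth-cover (p ∷ S) k with sat-∷ S
  nth-cover (p ∷ S) zero    | c , refl = inj₁ (subst (_ ⋖_) (sym (nth-zero _ c)) p)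
  nth-cover (p ∷ S) (suc k) | _ , refl = nth-cover S k

  leftModular⇒shellable : ∀ {F} → Sat bot top F → All LeftModularElement F → ELShellable × Shellable
  leftModular⇒shellable S lm with sat-∷ S
  ... | c , refl = L.elShellable , L.shellable
    where
    f-≤ : ∀ k → nth bot c k ≤ nth bot c (suc k)
    f-≤ k = [ proj₁ ∘ proj₁ , O.reflexive ] (nth-cover S k)
    f-step : ∀ k {z} → nth bot c k ≤ z → z ≤ nth bot c (suc k) → z ≡ nth bot c k ⊎ z ≡ nth bot c (suc k)
    f-step k p q = [ (λ cov → ⋖-≤ cov p q) ,
                     (λ eq → inj₁ (O.antisym (O.trans q (O.reflexive (sym eq))) p)) ] (nth-cover S k)
    module L = Labelling (nth bot c) (length c) (nth-zero bot c) (nth-last S)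
                 (λ k → All.lookup lm (nth-∈ bot c k)) f-≤ f-step

-- Duality and extremality

op : FinLattice → FinLattice
op K = record
  { n = n ; _≤_ = flip _≤_ ; _∨_ = _∧_ ; _∧_ = _∨_
  ; isLattice = record
    { isPartialOrder = Flip.isPartialOrder O.isPartialOrder
    ; supremum = O.infimum ; infimum = O.supremum } }
  where
  open FinLattice K
  module O = IsLattice isLattice

module Dual (K : FinLattice) (e : FinLattice.Elt K) where
  open FinLattice K
  open Chains K
  open Bounded K e
  private
    module Kᵒ = FinLattice (op K)
    module Cᵒ = Chains (op K)
    module Bᵒ = Bounded (op K) e

  ⋖⇒⋖ᵒ : ∀ {x y} → x ⋖ y → y Kᵒ.⋖ x
  ⋖⇒⋖ᵒ ((x≤y , ne) , gap) =
    (x≤y , ne ∘ sym) , λ z (z≤y , y≢z) (x≤z , z≢x) → gap z (x≤z , z≢x ∘ sym) (z≤y , y≢z ∘ sym)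

  ⋖ᵒ⇒⋖ : ∀ {x y} → y Kᵒ.⋖ x → x ⋖ y
  ⋖ᵒ⇒⋖ ((x≤y , ne) , gap) =
    (x≤y , ne ∘ sym) , λ z (x≤z , x≢z) (z≤y , z≢y) → gap z (z≤y , z≢y ∘ sym) (x≤z , x≢z ∘ sym)

  jiᵒ⇒mi : ∀ {x} → Kᵒ.JoinIrreducible x → MeetIrreducible x
  jiᵒ⇒mi (y , c , uniq) = y , ⋖ᵒ⇒⋖ c , λ z → uniq z ∘ ⋖⇒⋖ᵒ

  mi⇒jiᵒ : ∀ {x} → MeetIrreducible x → Kᵒ.JoinIrreducible x
  mi⇒jiᵒ (y , c , uniq) = y , ⋖⇒⋖ᵒ c , λ z → uniq z ∘ ⋖ᵒ⇒⋖

  sat-reverse : ∀ {x y c} → Sat x y c → ∃[ d ] (Cᵒ.Sat y x d × d ⊆ c × length d ≡ length c)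
  sat-reverse [-] = _ , Cᵒ.[-] , id , refl
  sat-reverse {x} (p ∷ S) with sat-reverse S
  ... | d , Sᵒ , sub , len = d ++ x ∷ [] , Cᵒ.sat-++ Sᵒ (⋖⇒⋖ᵒ p Cᵒ.∷ Cᵒ.[-]) ,
    (λ t∈ → [ there ∘ sub , (λ { (here refl) → here refl }) ] (∈.∈-++⁻ d t∈)) ,
    trans (List.length-++ d) (trans (ℕ.+-comm (length d) 1) (cong suc len))

  -- The modular law is self-dual once `b` and `c` are exchanged.
  leftModularᵒ : ∀ {a} → LeftModularElement a → Kᵒ.LeftModularElement a
  leftModularᵒ {a} lm b c (c≤b , b≢c) = trans (∨-comm _ c)
    (trans (cong (c ∨_) (∧-comm b a)) (trans (sym (lm c b (c≤b , b≢c ∘ sym)))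
      (trans (∧-comm _ b) (cong (b ∧_) (∨-comm c a)))))

  -- The chain sees every join-irreducible, which yields their number and bounds all chains.
  -- Reversed, it is a left modular maximal chain of `op K`, whose bottom and top are definitionally
  -- `top` and `bot`; the same count there gives the meet-irreducibles.
  leftModular⇒extremal : JoinSD _≤_ → MeetSD _≤_ → ∀ {F} → Sat bot top F → All LeftModularElement F → Extremal
  leftModular⇒extremal jsd msd {F} S lm with sat-reverse S
  ... | d , Sᵒ , sub , len =
    length F ∸ 1 , ((F , sat-chain S , size S) , λ xs → chain-length-≤ count) , count ,
    let xs , uniq , mem , k = countᵒ in
      xs , uniq , (λ x → proj₁ (mem x) ∘ mi⇒jiᵒ , jiᵒ⇒mi ∘ proj₂ (mem x)) , trans k (cong (_∸ 1) len)
    where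
    count : HasCount JoinIrreducible (length F ∸ 1)
    count = sees⇒count jsd S (leftModular⇒sees S lm)
    countᵒ : Kᵒ.HasCount Kᵒ.JoinIrreducible (length d ∸ 1)
    countᵒ = Bᵒ.sees⇒count msd Sᵒ (Bᵒ.leftModular⇒sees Sᵒ (All.tabulate (leftModularᵒ ∘ All.lookup lm ∘ sub)))
    size : ∀ {x y c} → Sat x y c → length c ≡ suc (length c ∸ 1)
    size [-]     = refl
    size (_ ∷ _) = refl

-- The equivalences, all routed through left modularity

theorem3p26 : (L : FinLattice) → CongruenceUniform L →
    (FinLattice.Extremal L ⇔ FinLattice.LeftModular L) ×
    (FinLattice.LeftModular L ⇔ FinLattice.ELShellable L) ×
    (FinLattice.ELShellable L ⇔ FinLattice.Shellable L)
theorem3p26 L cu with congruenceUniform⇒semidistributive L cu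
... | e , jsd , msd =
  mk⇔ extremal⇒lm lm⇒extremal ,
  mk⇔ (proj₁ ∘ lm⇒shellable) el⇒lm ,
  mk⇔ (proj₂ ∘ lm⇒shellable ∘ el⇒lm) (proj₁ ∘ lm⇒shellable ∘ shellable⇒lm)
  where
  open FinLattice L
  open Chains L
  open Bounded L e
  module Sh = Shellings L e

  sees⇒lm : ∃[ F ] (Sat bot top F × Sees F) → LeftModular
  sees⇒lm (F , S , sees) = F , sat⇒maximal S , All.tabulate (sees⇒leftModular msd S sees)

  extremal⇒lm : Extremal → LeftModular
  extremal⇒lm = sees⇒lm ∘ extremal⇒sees

  shellable⇒lm : Shellable → LeftModular
  shellable⇒lm = sees⇒lm ∘ Sh.shellable⇒sees jsd

  el⇒lm : ELShellable → LeftModular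
  el⇒lm (P , lab , el) = sees⇒lm (Sh.Labelled.EL.increasing-facet-sees P lab el jsd)

  lm⇒extremal : LeftModular → Extremal
  lm⇒extremal (F , max , lm) = Dual.leftModular⇒extremal L e jsd msd (maximal⇒sat max) lm

  lm⇒shellable : LeftModular → ELShellable × Shellable
  lm⇒shellable (F , max , lm) = LeftModularLabelling.leftModular⇒shellable L e (maximal⇒sat max) lm
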